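{- (i) There exist edge expanders that are not triangle expanders. (ii) Assume the following conjecture: $G\sim G(n,p)$ with $p=\frac{\log n}{n^{2/3}}$ is a triangle expander with high probability (i.e., with probability tending to $1$ as $n\to\infty$). Then there exist triangle expanders that are not edge expanders.
   Context: Graphs are undirected. For a graph $G(V,E,w)$ on $n$ vertices with weight function $w:E\to\mathbb{R}^+$ (an unweighted graph $G(V,E)$ has all edge weights equal to $1$), let $\deg(u)=\sum_{v}w(u,v)$. For $S\subseteq V$ with complement $\bar S$, let $w(S:\bar S)=\sum_{i\in S,\,j\in\bar S}w(i,j)$ and $\mathrm{vol}(S)=\sum_{u\in S}\deg(u)$. The edge expansion of $S$ is $$\phi(S)=\frac{w(S:\bar S)}{\min(\mathrm{vol}(S),\mathrm{vol}(\bar S))}.$$ A graph $G(V,E,w)$ is an (edge) expander if all subsets $S\subseteq V$ with $|S|\le 0.5n$ have edge expansion $\phi(S)=\Theta(1)$. For an unweighted, undirected graph $G(V,E)$ on $n$ vertices, let $t(v)$ be the number of triangles containing the vertex $v$, let $t_i(S)$ be the number of triangles with exactly $i$ vertices in $S$, and let $\mathrm{vol}_3(S)=\sum_{v\in S}t(v)=3t_3(S)+2t_2(S)+t_1(S)$. The triangle expansion of $S$ is $$\phi_3(S)=\frac{t_2(S)+t_1(S)}{\mathrm{vol}_3(S)}.$$ A graph $G(V,E)$ is a triangle expander if all subsets $S\subseteq V$ with $|S|\le 0.5n$ have constant triangle expansion, i.e. $\phi_3(S)=\Theta(1)$. Here $S$ is nonempty, and the notions are understood asymptotically, for families of graphs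 with $n\to\infty$: $\Theta(1)$ means bounded below by a constant $c>0$ independent of $n$ and $S$ (both quantities are at most $1$). Both $\phi(S)$ and $\phi_3(S)$ are taken to be $0$ when the denominator is $0$. $G(n,p)$ is the Erdős–Rényi random graph on $n$ vertices, in which each pair of vertices is joined independently with probability $p$. -}

module Defs where

open import Data.Bool.Base using (Bool; true; false; _∧_; _∨_; if_then_else_)
open import Data.Fin.Base as Fin using (Fin; combine)
import Data.Fin.Properties as Fin
open import Data.Fin.Subset using (Subset; Nonempty; ∁; ∣_∣)
open import Data.Fin.Subset.Properties using (nonempty?; anySubset?)
open import Data.Integer.Base as ℤ using (+_)
import Data.Integer.Properties as ℤ
open import Data.Nat.Base as ℕ using (ℕ; zero; suc; z≤n; s≤s)
import Data.Nat.Properties as ℕ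
open import Data.Nat.Solver using () renaming (module +-*-Solver to NatSolver)
open import Data.Product.Base using (∃-syntax; _×_; _,_; proj₁; proj₂)
open import Data.Rational.Base as ℚ
  using (ℚ; 0ℚ; 1ℚ; ½; _+_; _*_; _-_; -_; _≤_; _<_; 1/_; _/_; toℚᵘ)
import Data.Rational.Properties as ℚ
open import Data.Rational.Solver using (module +-*-Solver)
import Data.Rational.Unnormalised.Base as ℚᵘ
import Data.Rational.Unnormalised.Properties as ℚᵘ
open import Data.Sum.Base using (inj₁; inj₂)
open import Data.Vec.Base using (Vec; []; _∷_; lookup)
open import Function.Base using (_∘_; it)
open import Relation.Binary.Definitions using (tri<; tri≈; tri>)
open import Relation.Binary.PropositionalEquality
  using (_≡_; refl; sym; trans; cong; cong₂; subst; subst₂)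
open import Relation.Nullary.Decidable
  using (Dec; yes; no; ⌊_⌋; does; map′; ¬?; _→-dec_; decidable-stable)
open import Relation.Nullary.Negation using (contradiction)
open import Relation.Unary using (Decidable)
open import Algebra.Properties.Semiring.Sum ℕ.+-*-semiring public
  using (sum; sum-syntax)

record Graph (n : ℕ) : Set where
  field
    adj        : Fin n → Fin n → Bool
    adj-sym    : ∀ u v → adj u v ≡ adj v u
    adj-irrefl : ∀ u → adj u u ≡ false

𝟙 : Bool → ℕ
𝟙 b = if b then 1 else 0

ratio : ℕ → ℕ → ℚ
ratio a zero    = 0ℚ
ratio a (suc b) = + a / suc b

-- The graphs are unweighted: w(u,v) is 𝟙 (adj u v).
module _ {n : ℕ} (G : Graph n) where
  open Graph G

  deg : Fin n → ℕ
  deg u = ∑[ v < n ] 𝟙 (adj u v)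

  cut : Subset n → Subset n → ℕ
  cut S T = ∑[ i < n ] ∑[ j < n ] 𝟙 (lookup S i ∧ lookup T j ∧ adj i j)

  vol : Subset n → ℕ
  vol S = ∑[ u < n ] (𝟙 (lookup S u) ℕ.* deg u)

  φ : Subset n → ℚ
  φ S = ratio (cut S (∁ S)) (vol S ℕ.⊓ vol (∁ S))

  -- Each triangle is counted once, through its increasing enumeration i < j < k.
  isTriangle : Fin n → Fin n → Fin n → Bool
  isTriangle i j k =
    ⌊ i Fin.<? j ⌋ ∧ ⌊ j Fin.<? k ⌋ ∧ adj i j ∧ adj j k ∧ adj i k

  #triangles : (Fin n → Fin n → Fin n → Bool) → ℕ
  #triangles P =
    ∑[ i < n ] ∑[ j < n ] ∑[ k < n ] 𝟙 (isTriangle i j k ∧ P i j k)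

  t : Fin n → ℕ
  t v = #triangles λ i j k → ⌊ v Fin.≟ i ⌋ ∨ ⌊ v Fin.≟ j ⌋ ∨ ⌊ v Fin.≟ k ⌋

  t⟨_⟩ : ℕ → Subset n → ℕ
  t⟨ r ⟩ S = #triangles λ i j k →
    ⌊ 𝟙 (lookup S i) ℕ.+ 𝟙 (lookup S j) ℕ.+ 𝟙 (lookup S k) ℕ.≟ r ⌋

  vol₃ : Subset n → ℕ
  vol₃ S = ∑[ v < n ] (𝟙 (lookup S v) ℕ.* t v)

  φ₃ : Subset n → ℚ
  φ₃ S = ratio (t⟨ 2 ⟩ S ℕ.+ t⟨ 1 ⟩ S) (vol₃ S)

  HasEdgeExpansion : ℚ → Set
  HasEdgeExpansion c = ∀ S → Nonempty S → 2 ℕ.* ∣ S ∣ ℕ.≤ n → c ≤ φ S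

  HasTriangleExpansion : ℚ → Set
  HasTriangleExpansion c = ∀ S → Nonempty S → 2 ℕ.* ∣ S ∣ ℕ.≤ n → c ≤ φ₃ S

record GraphFamily : Set where
  field
    size   : ℕ → ℕ
    graph  : ∀ k → Graph (size k)
    size→∞ : ∀ N → ∃[ K ] (∀ k → K ℕ.≤ k → N ℕ.≤ size k)

-- Θ(1) is asymptotic, so finitely many members are ignored; a family that fails
-- to be an expander fails for infinitely many members. A real constant c > 0 may
-- always be replaced by a smaller rational one.

IsEdgeExpander : GraphFamily → Set
IsEdgeExpander 𝒢 = ∃[ c ] 0ℚ < c × ∃[ K ] (∀ k → K ℕ.≤ k → HasEdgeExpansion (graph k) c)
  where open GraphFamily 𝒢

IsTriangleExpander : GraphFamily → Set
IsTriangleExpander 𝒢 = ∃[ c ] 0ℚ < c × ∃[ K ] (∀ k → K ℕ.≤ k → HasTriangleExpansion (graph k) c)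
  where open GraphFamily 𝒢

allSubset? : ∀ {n} {P : Subset n → Set} → Decidable P → Dec (∀ S → P S)
allSubset? P? = map′
  (λ ¬∃¬P S → decidable-stable (P? S) λ ¬PS → ¬∃¬P (S , ¬PS))
  (λ ∀P (S , ¬PS) → ¬PS (∀P S))
  (¬? (anySubset? (¬? ∘ P?)))

hasTriangleExpansion? : ∀ {n} (G : Graph n) c → Dec (HasTriangleExpansion G c)
hasTriangleExpansion? {n} G c = allSubset? λ S →
  nonempty? S →-dec (2 ℕ.* ∣ S ∣ ℕ.≤? n →-dec (c ℚ.≤? φ₃ G S))

∣_∣ℚ : ℚ → ℚ
∣_∣ℚ = ℚ.∣_∣

IsCauchy : (ℕ → ℚ) → Set
IsCauchy x = ∀ ε → 0ℚ < ε →
  ∃[ N ] (∀ k l → N ℕ.≤ k → N ℕ.≤ l → ∣ x k - x l ∣ℚ ≤ ε)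

record ℝ : Set where
  constructor mkℝ
  field
    seq    : ℕ → ℚ
    cauchy : IsCauchy seq
open ℝ public

infix 4 _≤ᵣ_
_≤ᵣ_ : ℝ → ℝ → Set
x ≤ᵣ y = ∀ ε → 0ℚ < ε → ∃[ N ] (∀ k → N ℕ.≤ k → seq x k ≤ seq y k + ε)

open +-*-Solver using (solve; _:+_; _:*_; _:-_; :-_; _:=_)

private abstract
  regroup-+ : ∀ a b c d → (a - b) + (c - d) ≡ (a + c) - (b + d)
  regroup-+ = solve 4 (λ a b c d → (a :- b) :+ (c :- d) := (a :+ c) :- (b :+ d)) refl

  regroup-* : ∀ a b c d → a * (c - d) + (a - b) * d ≡ a * c - b * d
  regroup-* = solve 4 (λ a b c d → a :* (c :- d) :+ (a :- b) :* d := a :* c :- b :* d) refl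

  regroup-1/ : ∀ a b u v → (b - a) * (u * v) ≡ u * (v * b) - (u * a) * v
  regroup-1/ = solve 4 (λ a b u v → (b :- a) :* (u :* v) := u :* (v :* b) :- (u :* a) :* v) refl

  regroup-δ : ∀ a b e i → a * (e * i) + (e * i) * b ≡ e * (i * (a + b))
  regroup-δ = solve 4 (λ a b e i → a :* (e :* i) :+ (e :* i) :* b := e :* (i :* (a :+ b))) refl

  p-q+q : ∀ p q → (p - q) + q ≡ p
  p-q+q = solve 2 (λ p q → (p :- q) :+ q := p) refl

  neg-sub : ∀ p q → - (p - q) ≡ q - p
  neg-sub = solve 2 (λ p q → :- (p :- q) := q :- p) refl

  sub-neg : ∀ p q → q - p ≡ - p - - q
  sub-neg = solve 2 (λ p q → q :- p := (:- p) :- (:- q)) refl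

  ∣∣-≤ : ∀ {p e} → p ≤ e → - p ≤ e → ∣ p ∣ℚ ≤ e
  ∣∣-≤ {p} p≤e -p≤e with ℚ.∣p∣≡p∨∣p∣≡-p p
  ... | inj₁ eq = ℚ.≤-trans (ℚ.≤-reflexive eq) p≤e
  ... | inj₂ eq = ℚ.≤-trans (ℚ.≤-reflexive eq) -p≤e

  0<1 : 0ℚ < 1ℚ
  0<1 = ℚ.positive⁻¹ 1ℚ

  0<* : ∀ {p q} → 0ℚ < p → 0ℚ < q → 0ℚ < p * q
  0<* {p} {q} 0<p 0<q =
    subst (_< p * q) (ℚ.*-zeroʳ p) (ℚ.*-monoʳ-<-pos p {{ℚ.positive 0<p}} 0<q)

  0≤* : ∀ {p q} → 0ℚ ≤ p → 0ℚ ≤ q → 0ℚ ≤ p * q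
  0≤* {p} {q} 0≤p 0≤q =
    subst (_≤ p * q) (ℚ.*-zeroʳ p) (ℚ.*-monoˡ-≤-nonNeg p {{ℚ.nonNegative 0≤p}} 0≤q)

  halve : ∀ {ε} → 0ℚ < ε → ∃[ δ ] 0ℚ < δ × δ + δ ≡ ε
  halve {ε} 0<ε = ½ * ε , 0<* (ℚ.positive⁻¹ ½) 0<ε ,
    trans (sym (ℚ.*-distribʳ-+ ε ½ ½)) (ℚ.*-identityˡ ε)

  divide : ∀ {a b ε} → 0ℚ < a → 0ℚ < b → 0ℚ < ε → ∃[ δ ] 0ℚ < δ × a * δ + δ * b ≡ ε
  divide {a} {b} {ε} 0<a 0<b 0<ε =
    ε * i , 0<* 0<ε (ℚ.positive⁻¹ i {{ℚ.1/pos⇒pos (a + b) {{ℚ.positive 0<a+b}}}}) ,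
    trans (regroup-δ a b ε i)
      (trans (cong (ε *_) (ℚ.*-inverseˡ (a + b) {{ℚ.>-nonZero 0<a+b}})) (ℚ.*-identityʳ ε))
    where
    0<a+b : 0ℚ < a + b
    0<a+b = ℚ.+-mono-< 0<a 0<b
    i : ℚ
    i = (1/ (a + b)) {{ℚ.>-nonZero 0<a+b}}

  *-mono : ∀ {a b c d} → 0ℚ ≤ b → 0ℚ ≤ c → a ≤ c → b ≤ d → a * b ≤ c * d
  *-mono {a} {b} {c} 0≤b 0≤c a≤c b≤d = ℚ.≤-trans
    (ℚ.*-monoʳ-≤-nonNeg b {{ℚ.nonNegative 0≤b}} a≤c)
    (ℚ.*-monoˡ-≤-nonNeg c {{ℚ.nonNegative 0≤c}} b≤d)

  ∣-∣-comm : ∀ p q → ∣ p - q ∣ℚ ≡ ∣ q - p ∣ℚ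
  ∣-∣-comm p q = trans (sym (ℚ.∣-p∣≡∣p∣ (p - q))) (cong ∣_∣ℚ (neg-sub p q))

  const-cauchy : ∀ q → IsCauchy (λ _ → q)
  const-cauchy q ε 0<ε = 0 , λ _ _ _ _ →
    ℚ.≤-trans (ℚ.≤-reflexive (cong ∣_∣ℚ (ℚ.+-inverseʳ q))) (ℚ.<⇒≤ 0<ε)

  +-cauchy : ∀ x y → IsCauchy x → IsCauchy y → IsCauchy (λ k → x k + y k)
  +-cauchy x y cx cy ε 0<ε =
    let δ , 0<δ , δ+δ≡ε = halve 0<ε
        N , f = cx δ 0<δ
        M , g = cy δ 0<δ
    in N ℕ.⊔ M , λ k l k≥ l≥ → subst₂ (λ z e → ∣ z ∣ℚ ≤ e)
         (regroup-+ (x k) (x l) (y k) (y l)) δ+δ≡ε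
         (ℚ.≤-trans (ℚ.∣p+q∣≤∣p∣+∣q∣ (x k - x l) (y k - y l))
           (ℚ.+-mono-≤ (f k l (ℕ.m⊔n≤o⇒m≤o N M k≥) (ℕ.m⊔n≤o⇒m≤o N M l≥))
                       (g k l (ℕ.m⊔n≤o⇒n≤o N M k≥) (ℕ.m⊔n≤o⇒n≤o N M l≥))))

  neg-cauchy : ∀ x → IsCauchy x → IsCauchy (λ k → - x k)
  neg-cauchy x cx ε 0<ε =
    let N , f = cx ε 0<ε
    in N , λ k l N≤k N≤l → subst (_≤ ε)
         (trans (∣-∣-comm (x k) (x l)) (cong ∣_∣ℚ (sub-neg (x k) (x l))))
         (f k l N≤k N≤l)

  eventually-bounded : ∀ x → IsCauchy x →
    ∃[ B ] 0ℚ < B × ∃[ N ] (∀ k → N ℕ.≤ k → ∣ x k ∣ℚ ≤ B)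
  eventually-bounded x cx =
    let N , f = cx 1ℚ 0<1
    in 1ℚ + ∣ x N ∣ℚ , ℚ.+-mono-<-≤ 0<1 (ℚ.0≤∣p∣ (x N)) , N , λ k N≤k → ℚ.≤-trans
         (subst (λ z → ∣ z ∣ℚ ≤ ∣ x k - x N ∣ℚ + ∣ x N ∣ℚ) (p-q+q (x k) (x N))
           (ℚ.∣p+q∣≤∣p∣+∣q∣ (x k - x N) (x N)))
         (ℚ.+-monoˡ-≤ ∣ x N ∣ℚ (f k N N≤k ℕ.≤-refl))

  *-cauchy : ∀ x y → IsCauchy x → IsCauchy y → IsCauchy (λ k → x k * y k)
  *-cauchy x y cx cy ε 0<ε =
    let A , 0<A , N₁ , bx = eventually-bounded x cx
        B , 0<B , N₂ , by = eventually-bounded y cy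
        δ , 0<δ , Aδ+δB≡ε = divide 0<A 0<B 0<ε
        M₁ , fx = cx δ 0<δ
        M₂ , fy = cy δ 0<δ
        N = N₁ ℕ.⊔ N₂
        M = M₁ ℕ.⊔ M₂
    in N ℕ.⊔ M , λ k l k≥ l≥ →
      let N≤k = ℕ.m⊔n≤o⇒m≤o N M k≥
          N≤l = ℕ.m⊔n≤o⇒m≤o N M l≥
          M≤k = ℕ.m⊔n≤o⇒n≤o N M k≥
          M≤l = ℕ.m⊔n≤o⇒n≤o N M l≥
          h₁ = ℚ.≤-trans (ℚ.≤-reflexive (ℚ.∣p*q∣≡∣p∣*∣q∣ (x k) (y k - y l)))
                 (*-mono (ℚ.0≤∣p∣ (y k - y l)) (ℚ.<⇒≤ 0<A)
                   (bx k (ℕ.m⊔n≤o⇒m≤o N₁ N₂ N≤k))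
                   (fy k l (ℕ.m⊔n≤o⇒n≤o M₁ M₂ M≤k) (ℕ.m⊔n≤o⇒n≤o M₁ M₂ M≤l)))
          h₂ = ℚ.≤-trans (ℚ.≤-reflexive (ℚ.∣p*q∣≡∣p∣*∣q∣ (x k - x l) (y l)))
                 (*-mono (ℚ.0≤∣p∣ (y l)) (ℚ.<⇒≤ 0<δ)
                   (fx k l (ℕ.m⊔n≤o⇒m≤o M₁ M₂ M≤k) (ℕ.m⊔n≤o⇒m≤o M₁ M₂ M≤l))
                   (by l (ℕ.m⊔n≤o⇒n≤o N₁ N₂ N≤l)))
      in subst₂ (λ z e → ∣ z ∣ℚ ≤ e) (regroup-* (x k) (x l) (y k) (y l)) Aδ+δB≡ε
           (ℚ.≤-trans (ℚ.∣p+q∣≤∣p∣+∣q∣ (x k * (y k - y l)) ((x k - x l) * y l))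
             (ℚ.+-mono-≤ h₁ h₂))

  1/-contracts : ∀ {a b u v} → 1ℚ ≤ a → 1ℚ ≤ b → 0ℚ ≤ u → 0ℚ ≤ v →
    u * a ≡ 1ℚ → v * b ≡ 1ℚ → ∣ u - v ∣ℚ ≤ ∣ a - b ∣ℚ
  1/-contracts {a} {b} {u} {v} 1≤a 1≤b 0≤u 0≤v ua≡1 vb≡1 =
    subst₂ _≤_ (sym eq) (ℚ.*-identityʳ ∣ a - b ∣ℚ)
      (ℚ.*-monoˡ-≤-nonNeg ∣ a - b ∣ℚ {{ℚ.nonNegative (ℚ.0≤∣p∣ (a - b))}}
        (*-mono 0≤v (ℚ.<⇒≤ 0<1) (≤1 1≤a 0≤u ua≡1) (≤1 1≤b 0≤v vb≡1)))
    where
    ≤1 : ∀ {a u} → 1ℚ ≤ a → 0ℚ ≤ u → u * a ≡ 1ℚ → u ≤ 1ℚ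
    ≤1 {a} {u} 1≤a 0≤u ua≡1 = subst₂ _≤_ (ℚ.*-identityʳ u) ua≡1
      (ℚ.*-monoˡ-≤-nonNeg u {{ℚ.nonNegative 0≤u}} 1≤a)
    u-v : (b - a) * (u * v) ≡ u - v
    u-v = trans (regroup-1/ a b u v)
      (cong₂ _-_ (trans (cong (u *_) vb≡1) (ℚ.*-identityʳ u))
                 (trans (cong (_* v) ua≡1) (ℚ.*-identityˡ v)))
    eq : ∣ u - v ∣ℚ ≡ ∣ a - b ∣ℚ * (u * v)
    eq = trans (cong ∣_∣ℚ (sym u-v))
      (trans (ℚ.∣p*q∣≡∣p∣*∣q∣ (b - a) (u * v))
        (cong₂ _*_ (∣-∣-comm b a) (ℚ.0≤p⇒∣p∣≡p (0≤* 0≤u 0≤v))))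

  1≤⇒0< : ∀ {q} → 1ℚ ≤ q → 0ℚ < q
  1≤⇒0< = ℚ.<-≤-trans 0<1

fromℚ : ℚ → ℝ
fromℚ q = mkℝ (λ _ → q) (const-cauchy q)

infixl 6 _+ᵣ_ _-ᵣ_
infixl 7 _*ᵣ_
infix  8 -ᵣ_

_+ᵣ_ : ℝ → ℝ → ℝ
x +ᵣ y = mkℝ (λ k → seq x k + seq y k) (+-cauchy (seq x) (seq y) (cauchy x) (cauchy y))

-ᵣ_ : ℝ → ℝ
-ᵣ x = mkℝ (λ k → - seq x k) (neg-cauchy (seq x) (cauchy x))

_-ᵣ_ : ℝ → ℝ → ℝ
x -ᵣ y = x +ᵣ -ᵣ y

_*ᵣ_ : ℝ → ℝ → ℝ
x *ᵣ y = mkℝ (λ k → seq x k * seq y k) (*-cauchy (seq x) (seq y) (cauchy x) (cauchy y))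

recip : (x : ℝ) → (∀ k → 1ℚ ≤ seq x k) → ℝ
recip x 1≤x = mkℝ x⁻¹ λ ε 0<ε →
  let N , f = cauchy x ε 0<ε
  in N , λ k l N≤k N≤l → ℚ.≤-trans
       (1/-contracts (1≤x k) (1≤x l) (0≤x⁻¹ k) (0≤x⁻¹ l) (x⁻¹*x k) (x⁻¹*x l))
       (f k l N≤k N≤l)
  where
  x⁻¹ : ℕ → ℚ
  x⁻¹ k = (1/ seq x k) {{ℚ.>-nonZero (1≤⇒0< (1≤x k))}}
  x⁻¹*x : ∀ k → x⁻¹ k * seq x k ≡ 1ℚ
  x⁻¹*x k = ℚ.*-inverseˡ (seq x k) {{ℚ.>-nonZero (1≤⇒0< (1≤x k))}}
  0≤x⁻¹ : ∀ k → 0ℚ ≤ x⁻¹ k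
  0≤x⁻¹ k = ℚ.<⇒≤ (ℚ.positive⁻¹ (x⁻¹ k) {{ℚ.1/pos⇒pos (seq x k) {{ℚ.positive (1≤⇒0< (1≤x k))}}}})

infix 4 _⟶_
_⟶_ : (ℕ → ℝ) → ℝ → Set
x ⟶ a = ∀ ε → 0ℚ < ε → ∃[ N ] (∀ n → N ℕ.≤ n →
  a -ᵣ fromℚ ε ≤ᵣ x n × x n ≤ᵣ a +ᵣ fromℚ ε)

1/[1+_] : ℕ → ℚ
1/[1+ k ] = + 1 / suc k

private abstract
  frac-≤ : ∀ a b c d .{{_ : ℕ.NonZero b}} .{{_ : ℕ.NonZero d}} →
    a ℕ.* d ℕ.≤ c ℕ.* b → + a / b ≤ + c / d
  frac-≤ a b@(suc b′) c d@(suc d′) ad≤cb = ℚ.toℚᵘ-cancel-≤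
    (ℚᵘ.≤-respˡ-≃ (ℚᵘ.≃-sym (ℚ.toℚᵘ-fromℚᵘ (ℚᵘ.mkℚᵘ (+ a) b′)))
      (ℚᵘ.≤-respʳ-≃ (ℚᵘ.≃-sym (ℚ.toℚᵘ-fromℚᵘ (ℚᵘ.mkℚᵘ (+ c) d′)))
        (ℚᵘ.*≤* (subst₂ ℤ._≤_ (ℤ.pos-* a d) (ℤ.pos-* c b) (ℤ.+≤+ ad≤cb)))))

  frac-≡ : ∀ a b c d .{{_ : ℕ.NonZero b}} .{{_ : ℕ.NonZero d}} →
    a ℕ.* d ≡ c ℕ.* b → + a / b ≡ + c / d
  frac-≡ a b c d eq = ℚ.≤-antisym
    (frac-≤ a b c d (ℕ.≤-reflexive eq)) (frac-≤ c d a b (ℕ.≤-reflexive (sym eq)))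

  frac-+ : ∀ a b c d .{{_ : ℕ.NonZero b}} .{{_ : ℕ.NonZero d}} →
    (+ a / b) + (+ c / d) ≡ (+ (a ℕ.* d ℕ.+ c ℕ.* b) / (b ℕ.* d)) {{ℕ.m*n≢0 b d}}
  frac-+ a b@(suc b′) c d@(suc d′) = ℚ.toℚᵘ-injective
    (ℚᵘ.≃-trans (ℚ.toℚᵘ-homo-+ (+ a / b) (+ c / d))
      (ℚᵘ.≃-trans
        (ℚᵘ.+-cong (ℚ.toℚᵘ-fromℚᵘ (ℚᵘ.mkℚᵘ (+ a) b′)) (ℚ.toℚᵘ-fromℚᵘ (ℚᵘ.mkℚᵘ (+ c) d′)))
        (ℚᵘ.≃-trans (ℚᵘ.≃-reflexive (cong (λ z → ℚᵘ.mkℚᵘ z (ℕ.pred (b ℕ.* d))) num))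
          (ℚᵘ.≃-sym (ℚ.toℚᵘ-fromℚᵘ
            (ℚᵘ.mkℚᵘ (+ (a ℕ.* d ℕ.+ c ℕ.* b)) (ℕ.pred (b ℕ.* d))))))))
    where
    num : + a ℤ.* + d ℤ.+ + c ℤ.* + b ≡ + (a ℕ.* d ℕ.+ c ℕ.* b)
    num = sym (trans (ℤ.pos-+ (a ℕ.* d) (c ℕ.* b)) (cong₂ ℤ._+_ (ℤ.pos-* a d) (ℤ.pos-* c b)))

  archimedean : ∀ {ε} → 0ℚ < ε → ∃[ N ] (∀ k → N ℕ.≤ k → 1/[1+ k ] ≤ ε)
  archimedean {ε@(ℚ.mkℚ (+ zero) _ _)} (ℚ.*<* (ℤ.+<+ ()))
  archimedean {ε@(ℚ.mkℚ ℤ.-[1+ _ ] _ _)} (ℚ.*<* ())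
  archimedean {ε@(ℚ.mkℚ (+ suc a) d _)} _ = d , λ k d≤k → ℚ.≤-trans
    (frac-≤ 1 (suc k) (suc a) (suc d)
      (ℕ.≤-trans (ℕ.≤-reflexive (ℕ.*-identityˡ (suc d)))
        (ℕ.≤-trans (s≤s d≤k) (ℕ.m≤m+n (suc k) (a ℕ.* suc k)))))
    (ℚ.≤-reflexive (ℚ.fromℚᵘ-toℚᵘ ε))

  p≤q+r⇒p-q≤r : ∀ {p q r} → p ≤ q + r → p - q ≤ r
  p≤q+r⇒p-q≤r {p} {q} {r} p≤q+r = subst (p - q ≤_)
    (solve 2 (λ q r → (q :+ r) :- q := r) refl q r) (ℚ.+-monoˡ-≤ (- q) p≤q+r)

  regular⇒cauchy : ∀ x → (∀ k l → x k ≤ x l + 1/[1+ l ]) → IsCauchy x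
  regular⇒cauchy x reg ε 0<ε =
    let N , f = archimedean 0<ε
    in N , λ k l N≤k N≤l → ∣∣-≤
         (ℚ.≤-trans (p≤q+r⇒p-q≤r (reg k l)) (f l N≤l))
         (ℚ.≤-trans (ℚ.≤-reflexive (neg-sub (x k) (x l)))
           (ℚ.≤-trans (p≤q+r⇒p-q≤r (reg l k)) (f k N≤k)))

-- ⌊ m^(1/3) ⌋
icbrt : ℕ → ℕ
icbrt zero    = zero
icbrt (suc m) =
  if does (suc (icbrt m) ℕ.^ 3 ℕ.≤? suc m) then suc (icbrt m) else icbrt m

-- Truncation of m^(1/3) to a multiple of 1/(k+1).
cbrt-seq : ℕ → ℕ → ℚ
cbrt-seq m k = + icbrt (m ℕ.* suc k ℕ.^ 3) / suc k

private abstract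
  icbrt-lower : ∀ m → icbrt m ℕ.^ 3 ℕ.≤ m
  icbrt-lower zero    = z≤n
  icbrt-lower (suc m) = step (icbrt m) (icbrt-lower m) (suc (icbrt m) ℕ.^ 3 ℕ.≤? suc m)
    where
    step : ∀ r → r ℕ.^ 3 ℕ.≤ m → (d : Dec (suc r ℕ.^ 3 ℕ.≤ suc m)) →
      (if does d then suc r else r) ℕ.^ 3 ℕ.≤ suc m
    step r r³≤m (yes le) = le
    step r r³≤m (no _)   = ℕ.m≤n⇒m≤1+n r³≤m

  icbrt-upper : ∀ m → m ℕ.< suc (icbrt m) ℕ.^ 3
  icbrt-upper zero    = s≤s z≤n
  icbrt-upper (suc m) = step (icbrt m) (icbrt-upper m) (suc (icbrt m) ℕ.^ 3 ℕ.≤? suc m)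
    where
    step : ∀ r → m ℕ.< suc r ℕ.^ 3 → (d : Dec (suc r ℕ.^ 3 ℕ.≤ suc m)) →
      suc m ℕ.< suc (if does d then suc r else r) ℕ.^ 3
    step r m<[1+r]³ (yes _) = ℕ.≤-<-trans m<[1+r]³ (ℕ.^-monoˡ-< 3 (ℕ.n<1+n (suc r)))
    step r m<[1+r]³ (no ≰)  = ℕ.≰⇒> ≰

  cube-cancel-< : ∀ {a b} → a ℕ.^ 3 ℕ.< b ℕ.^ 3 → a ℕ.< b
  cube-cancel-< {a} {b} a³<b³ with a ℕ.<? b
  ... | yes a<b = a<b
  ... | no  a≮b = contradiction a³<b³ (ℕ.≤⇒≯ (ℕ.^-monoˡ-≤ 3 (ℕ.≮⇒≥ a≮b)))

  ^3-* : ∀ a b → (a ℕ.* b) ℕ.^ 3 ≡ a ℕ.^ 3 ℕ.* b ℕ.^ 3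
  ^3-* = NatSolver.solve 2 (λ a b →
    (a ⊗ b) ⊗ ((a ⊗ b) ⊗ ((a ⊗ b) ⊗ NatSolver.con 1)) NatSolver.:=
    (a ⊗ (a ⊗ (a ⊗ NatSolver.con 1))) ⊗ (b ⊗ (b ⊗ (b ⊗ NatSolver.con 1)))) refl
    where open NatSolver using () renaming (_:*_ to _⊗_)

  swap-* : ∀ a b c → a ℕ.* b ℕ.* c ≡ a ℕ.* c ℕ.* b
  swap-* a b c = trans (ℕ.*-assoc a b c)
    (trans (cong (a ℕ.*_) (ℕ.*-comm b c)) (sym (ℕ.*-assoc a c b)))

  cross-< : ∀ m r s a b .{{_ : ℕ.NonZero a}} →
    r ℕ.^ 3 ℕ.≤ m ℕ.* a ℕ.^ 3 → m ℕ.* b ℕ.^ 3 ℕ.< s ℕ.^ 3 → r ℕ.* b ℕ.< s ℕ.* a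
  cross-< m r s a b r³≤ma³ mb³<s³ = cube-cancel-< (begin-strict
    (r ℕ.* b) ℕ.^ 3             ≡⟨ ^3-* r b ⟩
    r ℕ.^ 3 ℕ.* b ℕ.^ 3         ≤⟨ ℕ.*-monoˡ-≤ (b ℕ.^ 3) r³≤ma³ ⟩
    m ℕ.* a ℕ.^ 3 ℕ.* b ℕ.^ 3   ≡⟨ swap-* m (a ℕ.^ 3) (b ℕ.^ 3) ⟩
    m ℕ.* b ℕ.^ 3 ℕ.* a ℕ.^ 3   <⟨ ℕ.*-monoˡ-< (a ℕ.^ 3) {{ℕ.m^n≢0 a 3}} mb³<s³ ⟩
    s ℕ.^ 3 ℕ.* a ℕ.^ 3         ≡⟨ ^3-* s a ⟨
    (s ℕ.* a) ℕ.^ 3             ∎)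
    where open ℕ.≤-Reasoning

  frac-suc : ∀ s d .{{_ : ℕ.NonZero d}} → + suc s / d ≡ (+ s / d) + (+ 1 / d)
  frac-suc s d = trans
    (frac-≡ (suc s) d (s ℕ.* d ℕ.+ 1 ℕ.* d) (d ℕ.* d) {{it}} {{ℕ.m*n≢0 d d}}
      (trans (sym (ℕ.*-assoc (suc s) d d))
        (cong (ℕ._* d)
          (trans (ℕ.+-comm d (s ℕ.* d)) (cong (s ℕ.* d ℕ.+_) (sym (ℕ.*-identityˡ d)))))))
    (sym (frac-+ s d 1 d))

  cbrt-approx : ∀ m a b .{{_ : ℕ.NonZero a}} .{{_ : ℕ.NonZero b}} →
    + icbrt (m ℕ.* a ℕ.^ 3) / a ≤ (+ icbrt (m ℕ.* b ℕ.^ 3) / b) + (+ 1 / b)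
  cbrt-approx m a b = ℚ.≤-trans
    (frac-≤ (icbrt (m ℕ.* a ℕ.^ 3)) a (suc (icbrt (m ℕ.* b ℕ.^ 3))) b (ℕ.<⇒≤
      (cross-< m (icbrt (m ℕ.* a ℕ.^ 3)) (suc (icbrt (m ℕ.* b ℕ.^ 3))) a b
        (icbrt-lower (m ℕ.* a ℕ.^ 3)) (icbrt-upper (m ℕ.* b ℕ.^ 3)))))
    (ℚ.≤-reflexive (frac-suc (icbrt (m ℕ.* b ℕ.^ 3)) b))

  1≤cbrt-approx : ∀ m a .{{_ : ℕ.NonZero m}} .{{_ : ℕ.NonZero a}} →
    1ℚ ≤ + icbrt (m ℕ.* a ℕ.^ 3) / a
  1≤cbrt-approx m a = frac-≤ 1 1 (icbrt (m ℕ.* a ℕ.^ 3)) a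
    (subst₂ ℕ._≤_ (sym (ℕ.*-identityˡ a)) (sym (ℕ.*-identityʳ (icbrt (m ℕ.* a ℕ.^ 3))))
      (ℕ.s≤s⁻¹ (cube-cancel-<
        (ℕ.≤-<-trans (ℕ.m≤n*m (a ℕ.^ 3) m) (icbrt-upper (m ℕ.* a ℕ.^ 3))))))

  cbrt-regular : ∀ m k l → cbrt-seq m k ≤ cbrt-seq m l + 1/[1+ l ]
  cbrt-regular m k l = cbrt-approx m (suc k) (suc l)

  1≤cbrt-seq : ∀ m .{{_ : ℕ.NonZero m}} k → 1ℚ ≤ cbrt-seq m k
  1≤cbrt-seq m k = 1≤cbrt-approx m (suc k)

cbrt : ℕ → ℝ
cbrt m = mkℝ (cbrt-seq m) (regular⇒cauchy (cbrt-seq m) (cbrt-regular m))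

-- Partial sums of  - log (1 - 1/b) = Σ_{i ≥ 1} 1 / (i bⁱ)  for b = m + 2.
log-term : ℕ → ℕ → ℚ
log-term m i = (+ 1 / (suc i ℕ.* suc (suc m) ℕ.^ suc i))
  {{ℕ.m*n≢0 (suc i) _ {{_}} {{ℕ.m^n≢0 (suc (suc m)) (suc i)}}}}

log-seq : ℕ → ℕ → ℚ
log-seq m zero    = 0ℚ
log-seq m (suc k) = log-seq m k + log-term m k

private abstract
  suc-suc≤pow : ∀ m k → suc (suc k) ℕ.≤ suc (suc m) ℕ.^ suc k
  suc-suc≤pow m zero    = s≤s (s≤s z≤n)
  suc-suc≤pow m (suc k) = begin
    suc (suc (suc k))                  ≤⟨ s≤s (s≤s (ℕ.m≤n+m (suc k) k)) ⟩
    suc (suc (k ℕ.+ suc k))            ≡⟨ cong suc (ℕ.+-suc k (suc k)) ⟨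
    suc k ℕ.+ suc (suc k)              ≤⟨ ℕ.+-monoˡ-≤ (suc (suc k)) (ℕ.n≤1+n (suc k)) ⟩
    suc (suc k) ℕ.+ suc (suc k)        ≡⟨ cong (suc (suc k) ℕ.+_) (ℕ.+-identityʳ (suc (suc k))) ⟨
    2 ℕ.* suc (suc k)                  ≤⟨ ℕ.*-mono-≤ (s≤s (s≤s (z≤n {m}))) (suc-suc≤pow m k) ⟩
    suc (suc m) ℕ.* suc (suc m) ℕ.^ suc k ∎
    where open ℕ.≤-Reasoning

  log-term-nonneg : ∀ m k → 0ℚ ≤ log-term m k
  log-term-nonneg m k = frac-≤ 0 1 1 _
    {{_}} {{ℕ.m*n≢0 (suc k) _ {{_}} {{ℕ.m^n≢0 (suc (suc m)) (suc k)}}}} z≤n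

  frac-telescope : ∀ a b .{{_ : ℕ.NonZero a}} .{{_ : ℕ.NonZero b}} → b ≡ suc a →
    (+ 1 / (a ℕ.* b)) {{ℕ.m*n≢0 a b}} + (+ 1 / b) ≡ + 1 / a
  frac-telescope a b b≡1+a = trans
    (frac-+ 1 (a ℕ.* b) 1 b {{ℕ.m*n≢0 a b}})
    (frac-≡ (1 ℕ.* b ℕ.+ 1 ℕ.* (a ℕ.* b)) (a ℕ.* b ℕ.* b) 1 a
      {{ℕ.m*n≢0 (a ℕ.* b) b {{ℕ.m*n≢0 a b}}}}
      (trans
        (cong (ℕ._* a) (cong₂ ℕ._+_ (ℕ.*-identityˡ b) (ℕ.*-identityˡ (a ℕ.* b))))
        (trans (cong (λ c → c ℕ.* b ℕ.* a) (sym b≡1+a))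
          (trans (ℕ.*-comm (b ℕ.* b) a)
            (trans (sym (ℕ.*-assoc a b b)) (sym (ℕ.*-identityˡ (a ℕ.* b ℕ.* b))))))))

  log-term+1/≤1/ : ∀ m k → log-term m k + 1/[1+ suc k ] ≤ 1/[1+ k ]
  log-term+1/≤1/ m k = ℚ.≤-trans
    (ℚ.+-monoˡ-≤ 1/[1+ suc k ]
      (frac-≤ 1 (suc k ℕ.* suc (suc m) ℕ.^ suc k) 1 (suc k ℕ.* suc (suc k))
        {{ℕ.m*n≢0 (suc k) _ {{_}} {{ℕ.m^n≢0 (suc (suc m)) (suc k)}}}}
        (ℕ.*-monoʳ-≤ 1 (ℕ.*-monoʳ-≤ (suc k) (suc-suc≤pow m k)))))
    (ℚ.≤-reflexive (frac-telescope (suc k) (suc (suc k)) refl))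

  log-seq-mono : ∀ m {k l} → k ℕ.≤′ l → log-seq m k ≤ log-seq m l
  log-seq-mono m (ℕ.≤′-reflexive refl) = ℚ.≤-refl
  log-seq-mono m {k} (ℕ.≤′-step {n = l} k≤l) = ℚ.≤-trans (log-seq-mono m k≤l)
    (ℚ.≤-trans (ℚ.≤-reflexive (sym (ℚ.+-identityʳ (log-seq m l))))
      (ℚ.+-monoʳ-≤ (log-seq m l) (log-term-nonneg m l)))

  log-seq+1/-antimono : ∀ m {k l} → k ℕ.≤′ l →
    log-seq m l + 1/[1+ l ] ≤ log-seq m k + 1/[1+ k ]
  log-seq+1/-antimono m (ℕ.≤′-reflexive refl) = ℚ.≤-refl
  log-seq+1/-antimono m {k} (ℕ.≤′-step {n = l} k≤l) = ℚ.≤-trans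
    (ℚ.≤-trans (ℚ.≤-reflexive (ℚ.+-assoc (log-seq m l) (log-term m l) 1/[1+ suc l ]))
      (ℚ.+-monoʳ-≤ (log-seq m l) (log-term+1/≤1/ m l)))
    (log-seq+1/-antimono m k≤l)

  ≤-+1/ : ∀ p l → p ≤ p + 1/[1+ l ]
  ≤-+1/ p l = ℚ.≤-trans (ℚ.≤-reflexive (sym (ℚ.+-identityʳ p)))
    (ℚ.+-monoʳ-≤ p (frac-≤ 0 1 1 (suc l) z≤n))

  log-regular : ∀ m k l → log-seq m k ≤ log-seq m l + 1/[1+ l ]
  log-regular m k l with ℕ.≤-total k l
  ... | inj₁ k≤l = ℚ.≤-trans (log-seq-mono m (ℕ.≤⇒≤′ k≤l)) (≤-+1/ (log-seq m l) l)
  ... | inj₂ l≤k = ℚ.≤-trans (≤-+1/ (log-seq m k) k) (log-seq+1/-antimono m (ℕ.≤⇒≤′ l≤k))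

-- log n = Σ_{b = 2}^{n} - log (1 - 1/b) by telescoping; log 0 = 0 is a junk value.
log : ℕ → ℝ
log 0             = fromℚ 0ℚ
log 1             = fromℚ 0ℚ
log (suc (suc m)) = log (suc m) +ᵣ mkℝ (log-seq m) (regular⇒cauchy (log-seq m) (log-regular m))

log[n]/n^⅔ : ∀ n .{{_ : ℕ.NonZero n}} → ℝ
log[n]/n^⅔ n = log n *ᵣ recip (cbrt (n ℕ.^ 2)) (1≤cbrt-seq (n ℕ.^ 2) {{ℕ.m^n≢0 n 2}})

-- Probability of an event about m independent coins, each true with probability p.
ℙ : ℝ → ∀ {m} {A : Vec Bool m → Set} → Decidable A → ℝ
ℙ p {zero}  A? = if does (A? []) then fromℚ 1ℚ else fromℚ 0ℚ
ℙ p {suc m} A? = p *ᵣ ℙ p (A? ∘ (true ∷_)) +ᵣ (fromℚ 1ℚ -ᵣ p) *ᵣ ℙ p (A? ∘ (false ∷_))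

-- One coin for each (i , j); only those with i < j are read.
coinAdj : ∀ n → Vec Bool (n ℕ.* n) → Fin n → Fin n → Bool
coinAdj n ω i j with Fin.<-cmp i j
... | tri< _ _ _ = lookup ω (combine i j)
... | tri≈ _ _ _ = false
... | tri> _ _ _ = lookup ω (combine j i)

coinGraph : ∀ n → Vec Bool (n ℕ.* n) → Graph n
coinGraph n ω = record { adj = coinAdj n ω ; adj-sym = adj-sym ; adj-irrefl = adj-irrefl }
  where
  adj-sym : ∀ i j → coinAdj n ω i j ≡ coinAdj n ω j i
  adj-sym i j with Fin.<-cmp i j | Fin.<-cmp j i
  ... | tri< _ _ _   | tri> _ _ _ = refl
  ... | tri≈ _ _ _   | tri≈ _ _ _ = refl
  ... | tri> _ _ _   | tri< _ _ _ = refl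
  ... | tri< i<j _ _ | tri< _ _ i≯j = contradiction i<j i≯j
  ... | tri< _ i≢j _ | tri≈ _ j≡i _ = contradiction (sym j≡i) i≢j
  ... | tri≈ _ i≡j _ | tri< _ j≢i _ = contradiction (sym i≡j) j≢i
  ... | tri≈ _ i≡j _ | tri> _ j≢i _ = contradiction (sym i≡j) j≢i
  ... | tri> _ i≢j _ | tri≈ _ j≡i _ = contradiction (sym j≡i) i≢j
  ... | tri> i≮j _ _ | tri> _ _ i<j = contradiction i<j i≮j
  adj-irrefl : ∀ i → coinAdj n ω i i ≡ false
  adj-irrefl i with Fin.<-cmp i i
  ... | tri< _ i≢i _ = contradiction refl i≢i
  ... | tri≈ _ _ _   = refl
  ... | tri> _ i≢i _ = contradiction refl i≢i

-- G(n,p) is indexed from n = 1, where n^(2/3) ≥ 1. The constant c is chosen before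
-- n, and the event is that every admissible S has triangle expansion at least c.
RandomTriangleExpanderConjecture : Set
RandomTriangleExpanderConjecture = ∃[ c ] 0ℚ < c ×
  (λ n → ℙ (log[n]/n^⅔ (suc n))
            (λ ω → hasTriangleExpansion? (coinGraph (suc n) ω) c))
  ⟶ fromℚ 1ℚ

{-# OPTIONS --safe #-}
module Submission where

-- Both parts are witnessed by cones: the cone over a graph B has one further
-- vertex, the apex, joined to every vertex of B.
--
-- Stars are edge expanders and not triangle expanders. A star is the cone over
-- an edgeless graph. It has no triangles, so its triangle expansion is 0. For
-- a proper nonempty set S of vertices, the side of the cut that misses the
-- centre consists of leaves, and every edge at a leaf crosses the cut; the cut
-- therefore has the volume of that side, and the edge expansion is at least 1.
--
-- Some triangle expanders are not edge expanders, whatever happens in the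
-- random graph, so the implication holds because its conclusion does. Let B be
-- triangle-free and d-regular on n vertices, d > 0. The triangles of the cone
-- are the edges of B joined to the apex. Let S be a set of at most half the
-- vertices of the cone, and S' its part in B.
--   If the apex is not in S, no triangle lies inside S, so vol₃ S is at most
-- 2 (t₂ + t₁).
--   If the apex is in S, then vol₃ S = e + d |S'| with 2 e = n d, and the
-- triangles that are not inside S are the edges of B that leave S' or miss it.
-- As 2 |S'| < n, at least n d / 4 edges do so, while vol₃ S is at most n d.
-- Hence the cone has triangle expansion at least 1/4, whether or not B is
-- connected (cone-hasTriangleExpansion). If now a set S' of at most half the
-- vertices of B is a union of components of B, each of its vertices has d + 1
-- edges in the cone of which only the one to the apex leaves S', so S' has edge
-- expansion at most 1/(d+1) (φ-cone-upper). Two disjoint copies of the complete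
-- bipartite graph K(m,m) provide such a B with d = m, and m tends to infinity.

open import Defs
open import Data.Bool.Base using (Bool; true; false; not; _∧_; _∨_; _xor_)
open import Data.Bool.Properties using (∧-identityʳ; ∧-zeroʳ; xor-comm; xor-same)
open import Data.Fin.Base as Fin using (Fin; zero; suc)
import Data.Fin.Properties as Fin
open import Data.Fin.Subset using (Subset; Nonempty; _∈_; ∁; ∣_∣; ⁅_⁆)
open import Data.Fin.Subset.Properties
  using (∣p∣≤n; ∣p∣≤∣x∷p∣; ∣∁p∣≡n∸∣p∣; ∣⁅x⁆∣≡1; x∈⁅x⁆)
import Data.Integer.Base as ℤ
import Data.Integer.Properties as ℤ
open import Data.Nat.Base
open import Data.Nat.Properties
open import Algebra.Properties.Semiring.Sum +-*-semiring
  using (sum-cong-≗; sum-replicate-zero; ∑-distrib-+; ∑-comm; *-distribˡ-sum)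
open import Data.Nat.Tactic.RingSolver using (solve-∀)
open import Data.Product.Base using (Σ-syntax; ∃-syntax; _×_; _,_; proj₁; proj₂)
open import Data.Rational.Base as ℚ using (ℚ; 0ℚ; 1ℚ)
import Data.Rational.Properties as ℚ
import Data.Rational.Unnormalised.Base as ℚᵘ
import Data.Rational.Unnormalised.Properties as ℚᵘ
open import Data.Vec.Base using ([]; _∷_; lookup; tabulate; here; there)
open import Data.Vec.Properties using (lookup-map; lookup∘tabulate)
open import Function.Base using (_∘_)
open import Relation.Binary.PropositionalEquality
  using (_≡_; refl; sym; trans; cong; cong₂; subst; subst₂; module ≡-Reasoning)
open import Relation.Nullary.Decidable using (yes; no; ⌊_⌋; isYes≗does)
open import Relation.Nullary.Negation using (¬_; contradiction)

open Graph

private variable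
  n : ℕ

-- Finite sums and indicators

sum-mono : {f g : Fin n → ℕ} → (∀ i → f i ≤ g i) → sum f ≤ sum g
sum-mono {zero}  f≤g = z≤n
sum-mono {suc n} f≤g = +-mono-≤ (f≤g zero) (sum-mono (f≤g ∘ suc))

sum-zero : {f : Fin n → ℕ} → (∀ i → f i ≡ 0) → sum f ≡ 0
sum-zero {n} f≡0 = trans (sum-cong-≗ f≡0) (sum-replicate-zero n)

sum-const : ∀ n c → ∑[ i < n ] c ≡ n * c
sum-const zero    c = refl
sum-const (suc n) c = cong (c +_) (sum-const n c)

sum-select : (f : Fin n → ℕ) (i : Fin n) → ∑[ v < n ] (f v * 𝟙 ⌊ v Fin.≟ i ⌋) ≡ f i
sum-select f zero = trans
  (cong₂ _+_ (*-identityʳ (f zero)) (sum-zero (λ v → *-zeroʳ (f (suc v)))))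
  (+-identityʳ (f zero))
sum-select f (suc i) = cong₂ _+_ (*-zeroʳ (f zero)) (trans
  (sum-cong-≗ λ v → cong (λ b → f (suc v) * 𝟙 b)
    (trans (isYes≗does (suc v Fin.≟ suc i)) (sym (isYes≗does (v Fin.≟ i)))))
  (sum-select (f ∘ suc) i))

𝟙-∧ : ∀ a b → 𝟙 (a ∧ b) ≡ 𝟙 a * 𝟙 b
𝟙-∧ true  b = sym (+-identityʳ (𝟙 b))
𝟙-∧ false b = refl

-- The characteristic function of a set of vertices.
χ : Subset n → Fin n → ℕ
χ S v = 𝟙 (lookup S v)

∣∣≡sum : (S : Subset n) → ∣ S ∣ ≡ sum (χ S)
∣∣≡sum {zero}  [] = refl
∣∣≡sum {suc n} (true  ∷ S) = cong suc (∣∣≡sum S)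
∣∣≡sum {suc n} (false ∷ S) = ∣∣≡sum S

∈⇒0<∣∣ : {S : Subset n} {v : Fin n} → v ∈ S → 0 < ∣ S ∣
∈⇒0<∣∣ here = z<s
∈⇒0<∣∣ (there {y = y} {xs = S} v∈S) = ≤-trans (∈⇒0<∣∣ v∈S) (∣p∣≤∣x∷p∣ y S)

-- Sums over edges and over triangles

-- The sum of a weight w j k over the edges jk, each edge being taken once, with
-- j < k.
edgeSum : Graph n → (Fin n → Fin n → ℕ) → ℕ
edgeSum {n} G w = ∑[ j < n ] ∑[ k < n ] (𝟙 (⌊ j Fin.<? k ⌋ ∧ adj G j k) * w j k)

module _ (G : Graph n) where

  edgeSum-cong : ∀ {w w′} → (∀ j k → w j k ≡ w′ j k) → edgeSum G w ≡ edgeSum G w′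
  edgeSum-cong w≡w′ = sum-cong-≗ λ j → sum-cong-≗ λ k →
    cong (𝟙 (⌊ j Fin.<? k ⌋ ∧ adj G j k) *_) (w≡w′ j k)

  edgeSum-mono : ∀ {w w′} → (∀ j k → w j k ≤ w′ j k) → edgeSum G w ≤ edgeSum G w′
  edgeSum-mono w≤w′ = sum-mono λ j → sum-mono λ k →
    *-monoʳ-≤ (𝟙 (⌊ j Fin.<? k ⌋ ∧ adj G j k)) (w≤w′ j k)

  edgeSum-+ : ∀ w w′ → edgeSum G (λ j k → w j k + w′ j k) ≡ edgeSum G w + edgeSum G w′
  edgeSum-+ w w′ = trans
    (sum-cong-≗ λ j → trans
      (sum-cong-≗ λ k → *-distribˡ-+ (𝟙 (⌊ j Fin.<? k ⌋ ∧ adj G j k)) (w j k) (w′ j k))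
      (∑-distrib-+ (λ k → 𝟙 (⌊ j Fin.<? k ⌋ ∧ adj G j k) * w j k) _))
    (∑-distrib-+ (λ j → ∑[ k < n ] (𝟙 (⌊ j Fin.<? k ⌋ ∧ adj G j k) * w j k)) _)

  private
    edge : Fin n → Fin n → ℕ
    edge j k = 𝟙 (⌊ j Fin.<? k ⌋ ∧ adj G j k)

    edge-symmetrised : ∀ j k → edge j k + edge k j ≡ 𝟙 (adj G j k)
    edge-symmetrised j k with j Fin.<? k | k Fin.<? j
    ... | yes j<k | yes k<j = contradiction k<j (<-asym j<k)
    ... | yes _   | no  _   = +-identityʳ _
    ... | no  _   | yes _   = cong 𝟙 (adj-sym G k j)
    ... | no  j≮k | no  k≮j with Fin.toℕ-injective (≤-antisym (≮⇒≥ k≮j) (≮⇒≥ j≮k))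
    ...   | refl = cong 𝟙 (sym (adj-irrefl G j))

  -- The handshake lemma, weighted by a function on the vertices: each vertex is
  -- counted once for every edge at it.
  handshake : (f : Fin n → ℕ) →
    edgeSum G (λ j k → f j + f k) ≡ ∑[ j < n ] (f j * deg G j)
  handshake f = begin
    edgeSum G (λ j k → f j + f k)
      ≡⟨ edgeSum-+ (λ j k → f j) (λ j k → f k) ⟩
    (∑[ j < n ] ∑[ k < n ] (edge j k * f j)) + (∑[ j < n ] ∑[ k < n ] (edge j k * f k))
      ≡⟨ cong (∑[ j < n ] ∑[ k < n ] (edge j k * f j) +_) (∑-comm (λ j k → edge j k * f k)) ⟩
    (∑[ j < n ] ∑[ k < n ] (edge j k * f j)) + (∑[ j < n ] ∑[ k < n ] (edge k j * f j))
      ≡⟨ ∑-distrib-+ (λ j → ∑[ k < n ] (edge j k * f j)) _ ⟨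
    ∑[ j < n ] (∑[ k < n ] (edge j k * f j) + ∑[ k < n ] (edge k j * f j))
      ≡⟨ sum-cong-≗ at ⟩
    ∑[ j < n ] (f j * deg G j) ∎
    where
    open ≡-Reasoning
    at : ∀ j → ∑[ k < n ] (edge j k * f j) + ∑[ k < n ] (edge k j * f j) ≡ f j * deg G j
    at j = begin
      ∑[ k < n ] (edge j k * f j) + ∑[ k < n ] (edge k j * f j)
        ≡⟨ ∑-distrib-+ (λ k → edge j k * f j) _ ⟨
      ∑[ k < n ] (edge j k * f j + edge k j * f j)
        ≡⟨ sum-cong-≗ (λ k → trans (sym (*-distribʳ-+ (f j) (edge j k) (edge k j)))
             (trans (cong (_* f j) (edge-symmetrised j k)) (*-comm (𝟙 (adj G j k)) (f j)))) ⟩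
      ∑[ k < n ] (f j * 𝟙 (adj G j k))
        ≡⟨ *-distribˡ-sum (f j) (λ k → 𝟙 (adj G j k)) ⟨
      f j * deg G j ∎

-- The sum of a weight w i j k over the triangles ijk, each triangle being taken
-- once, with i < j < k.
triangleSum : Graph n → (Fin n → Fin n → Fin n → ℕ) → ℕ
triangleSum {n} G w =
  ∑[ i < n ] ∑[ j < n ] ∑[ k < n ] (𝟙 (isTriangle G i j k) * w i j k)

module _ (G : Graph n) where

  #triangles≡triangleSum : ∀ P →
    #triangles G P ≡ triangleSum G (λ i j k → 𝟙 (P i j k))
  #triangles≡triangleSum P = sum-cong-≗ λ i → sum-cong-≗ λ j → sum-cong-≗ λ k →
    𝟙-∧ (isTriangle G i j k) (P i j k)

  private
    triangle⇒< : ∀ i j k → isTriangle G i j k ≡ true → i Fin.< j × j Fin.< k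
    triangle⇒< i j k eq with i Fin.<? j | j Fin.<? k
    ... | yes i<j | yes j<k = i<j , j<k
    triangle⇒< i j k () | yes _ | no _
    triangle⇒< i j k () | no _  | _

    ∑³ : (Fin n → Fin n → Fin n → ℕ) → ℕ
    ∑³ f = ∑[ i < n ] ∑[ j < n ] ∑[ k < n ] f i j k

    *-distribˡ-∑³ : ∀ x f → x * ∑³ f ≡ ∑³ (λ i j k → x * f i j k)
    *-distribˡ-∑³ x f = trans (*-distribˡ-sum x (λ i → ∑[ j < n ] ∑[ k < n ] f i j k))
      (sum-cong-≗ λ i → trans (*-distribˡ-sum x (λ j → ∑[ k < n ] f i j k))
        (sum-cong-≗ λ j → *-distribˡ-sum x (f i j)))

    ∑-∑³-comm : (f : Fin n → Fin n → Fin n → Fin n → ℕ) →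
      ∑[ v < n ] ∑³ (f v) ≡ ∑³ (λ i j k → ∑[ v < n ] f v i j k)
    ∑-∑³-comm f = trans (∑-comm (λ v i → ∑[ j < n ] ∑[ k < n ] f v i j k))
      (sum-cong-≗ λ i → trans (∑-comm (λ v j → ∑[ k < n ] f v i j k))
        (sum-cong-≗ λ j → ∑-comm (λ v k → f v i j k)))

    -- The vertices of a triangle are distinct, so that membership in the set of
    -- its vertices is a disjoint union.
    𝟙-vertex : {i j k : Fin n} → i Fin.< j → j Fin.< k → ∀ v →
      𝟙 (⌊ v Fin.≟ i ⌋ ∨ ⌊ v Fin.≟ j ⌋ ∨ ⌊ v Fin.≟ k ⌋)
        ≡ 𝟙 ⌊ v Fin.≟ i ⌋ + 𝟙 ⌊ v Fin.≟ j ⌋ + 𝟙 ⌊ v Fin.≟ k ⌋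
    𝟙-vertex {i} {j} {k} i<j j<k v with v Fin.≟ i | v Fin.≟ j | v Fin.≟ k
    ... | yes refl | yes refl | _        = contradiction i<j (Fin.<-irrefl refl)
    ... | yes refl | no _     | yes refl = contradiction i<j (<-asym j<k)
    ... | no _     | yes refl | yes refl = contradiction j<k (Fin.<-irrefl refl)
    ... | yes _    | no _     | no _     = refl
    ... | no _     | yes _    | no _     = refl
    ... | no _     | no _     | yes _    = refl
    ... | no _     | no _     | no _     = refl

  -- Double counting of the pairs of a triangle and a vertex of it in S.
  vol₃≡triangleSum : ∀ S → vol₃ G S ≡ triangleSum G (λ i j k → χ S i + χ S j + χ S k)
  vol₃≡triangleSum S = begin
    ∑[ v < n ] (χ S v * t G v)
      ≡⟨ sum-cong-≗ (λ v → cong (χ S v *_) (#triangles≡triangleSum (vertex v))) ⟩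
    ∑[ v < n ] (χ S v * ∑³ (λ i j k → 𝟙 (isTriangle G i j k) * 𝟙 (vertex v i j k)))
      ≡⟨ sum-cong-≗ (λ v → *-distribˡ-∑³ (χ S v) _) ⟩
    ∑[ v < n ] ∑³ (λ i j k → χ S v * (𝟙 (isTriangle G i j k) * 𝟙 (vertex v i j k)))
      ≡⟨ ∑-∑³-comm (λ v i j k → χ S v * (𝟙 (isTriangle G i j k) * 𝟙 (vertex v i j k))) ⟩
    ∑³ (λ i j k → ∑[ v < n ] (χ S v * (𝟙 (isTriangle G i j k) * 𝟙 (vertex v i j k))))
      ≡⟨ sum-cong-≗ (λ i → sum-cong-≗ λ j → sum-cong-≗ λ k →
           at i j k (isTriangle G i j k) refl) ⟩
    triangleSum G (λ i j k → χ S i + χ S j + χ S k) ∎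
    where
    open ≡-Reasoning
    vertex : Fin n → Fin n → Fin n → Fin n → Bool
    vertex v i j k = ⌊ v Fin.≟ i ⌋ ∨ ⌊ v Fin.≟ j ⌋ ∨ ⌊ v Fin.≟ k ⌋
    at : ∀ i j k b → isTriangle G i j k ≡ b →
      ∑[ v < n ] (χ S v * (𝟙 b * 𝟙 (vertex v i j k))) ≡ 𝟙 b * (χ S i + χ S j + χ S k)
    at i j k false _  = sum-zero λ v → *-zeroʳ (χ S v)
    at i j k true  eq = begin
      ∑[ v < n ] (χ S v * (1 * 𝟙 (vertex v i j k)))
        ≡⟨ sum-cong-≗ (λ v → cong (χ S v *_) (trans (*-identityˡ _)
             (𝟙-vertex (proj₁ (triangle⇒< i j k eq)) (proj₂ (triangle⇒< i j k eq)) v))) ⟩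
      ∑[ v < n ] (χ S v * (is i v + is j v + is k v))
        ≡⟨ sum-cong-≗ (λ v → trans (*-distribˡ-+ (χ S v) (is i v + is j v) (is k v))
             (cong (_+ χ S v * is k v) (*-distribˡ-+ (χ S v) (is i v) (is j v)))) ⟩
      ∑[ v < n ] (χ S v * is i v + χ S v * is j v + χ S v * is k v)
        ≡⟨ ∑-distrib-+ (λ v → χ S v * is i v + χ S v * is j v) _ ⟩
      ∑[ v < n ] (χ S v * is i v + χ S v * is j v) + ∑[ v < n ] (χ S v * is k v)
        ≡⟨ cong (_+ ∑[ v < n ] (χ S v * is k v)) (∑-distrib-+ (λ v → χ S v * is i v) _) ⟩
      ∑[ v < n ] (χ S v * is i v) + ∑[ v < n ] (χ S v * is j v) + ∑[ v < n ] (χ S v * is k v)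
        ≡⟨ cong₂ _+_ (cong₂ _+_ (sum-select (χ S) i) (sum-select (χ S) j)) (sum-select (χ S) k) ⟩
      χ S i + χ S j + χ S k
        ≡⟨ *-identityˡ _ ⟨
      1 * (χ S i + χ S j + χ S k) ∎
      where
      is : Fin n → Fin n → ℕ
      is u v = 𝟙 ⌊ v Fin.≟ u ⌋

-- Cones

-- The cone over B: the apex is the vertex zero, and suc embeds B.
cone : Graph n → Graph (suc n)
cone {n} B = record { adj = adj′ ; adj-sym = adj′-sym ; adj-irrefl = adj′-irrefl }
  where
  adj′ : Fin (suc n) → Fin (suc n) → Bool
  adj′ zero    zero    = false
  adj′ zero    (suc v) = true
  adj′ (suc u) zero    = true
  adj′ (suc u) (suc v) = adj B u v
  adj′-sym : ∀ u v → adj′ u v ≡ adj′ v u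
  adj′-sym zero    zero    = refl
  adj′-sym zero    (suc v) = refl
  adj′-sym (suc u) zero    = refl
  adj′-sym (suc u) (suc v) = adj-sym B u v
  adj′-irrefl : ∀ u → adj′ u u ≡ false
  adj′-irrefl zero    = refl
  adj′-irrefl (suc u) = adj-irrefl B u

-- Both decisions carry the same Boolean, but isYes is stuck on an open decision,
-- so the equation goes through does.
⌊suc<?suc⌋ : (i j : Fin n) → ⌊ suc i Fin.<? suc j ⌋ ≡ ⌊ i Fin.<? j ⌋
⌊suc<?suc⌋ i j = trans (isYes≗does (suc i Fin.<? suc j)) (sym (isYes≗does (i Fin.<? j)))

-- No three vertices are pairwise adjacent. The vertices need not be assumed
-- distinct, since adjacency is irreflexive.
TriangleFree : Graph n → Set
TriangleFree G = ∀ i j k → adj G i j ∧ adj G j k ∧ adj G i k ≡ false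

-- Every vertex has degree d.
Regular : ℕ → Graph n → Set
Regular d G = ∀ v → deg G v ≡ d

-- The triangles of the cone over a triangle-free graph are the apex together with
-- an edge of the base. The apex, being the least vertex, always comes first.
triangleSum-cone : (B : Graph n) → TriangleFree B → ∀ w →
  triangleSum (cone B) w ≡ edgeSum B (λ j k → w zero (suc j) (suc k))
triangleSum-cone {n} B free w = begin
  triangleSum (cone B) w
    ≡⟨⟩
  (∑[ k < suc n ] (0 * w zero zero k) + edgesAtApex) + avoidingApex
    ≡⟨ cong₂ (λ a b → a + edgesAtApex + b)
         (sum-zero {f = λ k → 0 * w zero zero k} (λ _ → refl)) avoidingApex≡0 ⟩
  edgesAtApex + 0
    ≡⟨ +-identityʳ _ ⟩
  edgesAtApex
    ≡⟨ sum-cong-≗ (λ j → sum-cong-≗ λ k →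
         cong₂ (λ a b → 𝟙 (a ∧ b) * w zero (suc j) (suc k))
           (⌊suc<?suc⌋ j k) (∧-identityʳ (adj B j k))) ⟩
  edgeSum B (λ j k → w zero (suc j) (suc k)) ∎
  where
  open ≡-Reasoning
  edgesAtApex avoidingApex : ℕ
  edgesAtApex = ∑[ j < n ] ∑[ k < n ]
    (𝟙 (isTriangle (cone B) zero (suc j) (suc k)) * w zero (suc j) (suc k))
  avoidingApex = ∑[ i < n ] ∑[ j < suc n ] ∑[ k < suc n ]
    (𝟙 (isTriangle (cone B) (suc i) j k) * w (suc i) j k)
  no-triangle : ∀ i j k → isTriangle (cone B) (suc i) j k ≡ false
  no-triangle i zero    k       = refl
  no-triangle i (suc j) zero    = ∧-zeroʳ ⌊ suc i Fin.<? suc j ⌋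
  no-triangle i (suc j) (suc k) = trans
    (cong (λ b → ⌊ suc i Fin.<? suc j ⌋ ∧ ⌊ suc j Fin.<? suc k ⌋ ∧ b) (free i j k))
    (trans (cong (⌊ suc i Fin.<? suc j ⌋ ∧_) (∧-zeroʳ ⌊ suc j Fin.<? suc k ⌋))
      (∧-zeroʳ ⌊ suc i Fin.<? suc j ⌋))
  avoidingApex≡0 : avoidingApex ≡ 0
  avoidingApex≡0 = sum-zero λ i → sum-zero λ j → sum-zero λ k →
    cong (λ b → 𝟙 b * w (suc i) j k) (no-triangle i j k)

-- Bounds on ratios

frac-≤ : ∀ a b c d → a * suc d ≤ c * suc b → ℤ.+ a ℚ./ suc b ℚ.≤ ℤ.+ c ℚ./ suc d
frac-≤ a b c d ad≤cb = ℚ.toℚᵘ-cancel-≤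
  (ℚᵘ.≤-respˡ-≃ (ℚᵘ.≃-sym (ℚ.toℚᵘ-fromℚᵘ (ℚᵘ.mkℚᵘ (ℤ.+ a) b)))
    (ℚᵘ.≤-respʳ-≃ (ℚᵘ.≃-sym (ℚ.toℚᵘ-fromℚᵘ (ℚᵘ.mkℚᵘ (ℤ.+ c) d)))
      (ℚᵘ.*≤* (subst₂ ℤ._≤_ (ℤ.pos-* a (suc d)) (ℤ.pos-* c (suc b)) (ℤ.+≤+ ad≤cb)))))

ratio-lower : ∀ q {a b} → 0 < b → b ≤ suc q * a → 1/[1+ q ] ℚ.≤ ratio a b
ratio-lower q {a} {suc b} _ b≤qa = frac-≤ 1 q a b
  (subst₂ _≤_ (sym (*-identityˡ (suc b))) (*-comm (suc q) a) b≤qa)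

ratio-upper : ∀ q {a b} → a * suc q ≤ b → ratio a b ℚ.≤ 1/[1+ q ]
ratio-upper q {a} {zero}  _    = frac-≤ 0 0 1 q z≤n
ratio-upper q {a} {suc b} aq≤b = frac-≤ a b 1 q
  (subst (a * suc q ≤_) (sym (*-identityˡ (suc b))) aq≤b)

-- Every positive rational exceeds all but finitely many 1/(k+1).
archimedean : ∀ {c} → 0ℚ ℚ.< c → ∃[ N ] (∀ k → N ≤ k → 1/[1+ k ] ℚ.< c)
archimedean {ℚ.mkℚ (ℤ.+ zero)  _ _} (ℚ.*<* (ℤ.+<+ ()))
archimedean {ℚ.mkℚ ℤ.-[1+ _ ] _ _} (ℚ.*<* ())
archimedean {c@(ℚ.mkℚ (ℤ.+ suc a) d _)} _ = suc d , λ k d<k →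
  ℚ.toℚᵘ-cancel-< (ℚᵘ.<-respˡ-≃
    (ℚᵘ.≃-sym (ℚ.toℚᵘ-fromℚᵘ (ℚᵘ.mkℚᵘ (ℤ.+ 1) k)))
    (ℚᵘ.*<* (subst₂ ℤ._<_ (ℤ.pos-* 1 (suc d)) (ℤ.pos-* (suc a) (suc k))
      (ℤ.+<+ (<-≤-trans
        (subst (_< suc k) (sym (*-identityˡ (suc d))) (s≤s d<k))
        (m≤m+n (suc k) (a * suc k)))))))

-- Triangle expansion of cones

module _ (B : Graph n) where

  t₂+t₁-cone : TriangleFree B → ∀ h S →
    t⟨ cone B ⟩ 2 (h ∷ S) + t⟨ cone B ⟩ 1 (h ∷ S) ≡
    edgeSum B (λ j k → 𝟙 ⌊ 𝟙 h + χ S j + χ S k ≟ 2 ⌋ + 𝟙 ⌊ 𝟙 h + χ S j + χ S k ≟ 1 ⌋)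
  t₂+t₁-cone free h S = trans (cong₂ _+_ (t-cone 2) (t-cone 1)) (sym (edgeSum-+ B _ _))
    where
    t-cone : ∀ r → t⟨ cone B ⟩ r (h ∷ S) ≡
      edgeSum B (λ j k → 𝟙 ⌊ 𝟙 h + χ S j + χ S k ≟ r ⌋)
    t-cone r = trans
      (#triangles≡triangleSum (cone B)
        (λ i j k → ⌊ χ (h ∷ S) i + χ (h ∷ S) j + χ (h ∷ S) k ≟ r ⌋))
      (triangleSum-cone B free
        (λ i j k → 𝟙 ⌊ χ (h ∷ S) i + χ (h ∷ S) j + χ (h ∷ S) k ≟ r ⌋))

  vol₃-cone : TriangleFree B → ∀ h S →
    vol₃ (cone B) (h ∷ S) ≡ edgeSum B (λ j k → 𝟙 h + χ S j + χ S k)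
  vol₃-cone free h S = trans (vol₃≡triangleSum (cone B) (h ∷ S))
    (triangleSum-cone B free (λ i j k → χ (h ∷ S) i + χ (h ∷ S) j + χ (h ∷ S) k))

  module _ {d : ℕ} (regular : Regular d B) where

    handshake-regular : (f : Fin n → ℕ) → edgeSum B (λ j k → f j + f k) ≡ sum f * d
    handshake-regular f = begin
      edgeSum B (λ j k → f j + f k) ≡⟨ handshake B f ⟩
      ∑[ j < n ] (f j * deg B j)    ≡⟨ sum-cong-≗ (λ j →
        trans (cong (f j *_) (regular j)) (*-comm (f j) d)) ⟩
      ∑[ j < n ] (d * f j)          ≡⟨ *-distribˡ-sum d f ⟨
      d * sum f                     ≡⟨ *-comm d (sum f) ⟩
      sum f * d                     ∎
      where open ≡-Reasoning

    handshake-subset : (S : Subset n) → edgeSum B (λ j k → χ S j + χ S k) ≡ ∣ S ∣ * d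
    handshake-subset S = trans (handshake-regular (χ S)) (cong (_* d) (sym (∣∣≡sum S)))

    handshake-all : edgeSum B (λ j k → 2) ≡ n * d
    handshake-all = trans (handshake-regular (λ _ → 1))
      (cong (_* d) (trans (sum-const n 1) (*-identityʳ n)))

    -- The constant 1/4 comes from the sets that contain the apex; the others have
    -- triangle expansion at least 1/2.
    cone-hasTriangleExpansion :
      TriangleFree B → 0 < d → HasTriangleExpansion (cone B) 1/[1+ 3 ]
    cone-hasTriangleExpansion free 0<d (false ∷ S) (suc v , there v∈S) _ =
      ratio-lower 3 0<vol (subst₂ _≤_ (sym vol≡) (cong (4 *_) (sym t≡)) vol≤4T)
      where
      T : ℕ
      T = edgeSum B (λ j k → 𝟙 ⌊ χ S j + χ S k ≟ 2 ⌋ + 𝟙 ⌊ χ S j + χ S k ≟ 1 ⌋)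
      t≡ = t₂+t₁-cone free false S
      vol≡ : vol₃ (cone B) (false ∷ S) ≡ ∣ S ∣ * d
      vol≡ = trans (vol₃-cone free false S) (handshake-subset S)
      0<vol : 0 < vol₃ (cone B) (false ∷ S)
      0<vol = subst (0 <_) (sym vol≡) (*-mono-≤ (∈⇒0<∣∣ v∈S) 0<d)
      -- A triangle adds at most 2 to vol₃ S, and if it adds anything, then it is
      -- counted by t₂ or t₁, as its apex is not in S.
      pointwise : ∀ a b → 𝟙 a + 𝟙 b ≤
        (𝟙 ⌊ 𝟙 a + 𝟙 b ≟ 2 ⌋ + 𝟙 ⌊ 𝟙 a + 𝟙 b ≟ 1 ⌋) + (𝟙 ⌊ 𝟙 a + 𝟙 b ≟ 2 ⌋ + 𝟙 ⌊ 𝟙 a + 𝟙 b ≟ 1 ⌋)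
      pointwise false false = z≤n
      pointwise false true  = s≤s z≤n
      pointwise true  false = s≤s z≤n
      pointwise true  true  = s≤s (s≤s z≤n)
      open ≤-Reasoning
      vol≤4T : ∣ S ∣ * d ≤ 4 * T
      vol≤4T = begin
        ∣ S ∣ * d                          ≡⟨ handshake-subset S ⟨
        edgeSum B (λ j k → χ S j + χ S k)  ≤⟨ edgeSum-mono B (λ j k → pointwise (lookup S j) (lookup S k)) ⟩
        _                                  ≡⟨ edgeSum-+ B _ _ ⟩
        T + T                              ≤⟨ m≤m+n (T + T) (T + T) ⟩
        T + T + (T + T)                    ≡⟨ double T ⟩
        4 * T                              ∎
        where
        double : ∀ x → x + x + (x + x) ≡ 4 * x
        double = solve-∀
    cone-hasTriangleExpansion free 0<d (true ∷ S) _ 2∣S∣≤n =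
      ratio-lower 3 0<vol (subst (vol₃ (cone B) (true ∷ S) ≤_) (cong (4 *_) (sym t≡)) vol≤4T)
      where
      -- Whether the triangle on the apex and an edge is not inside S, given which
      -- ends of the edge are in S.
      q : Bool → Bool → ℕ
      q a b = 𝟙 ⌊ 1 + 𝟙 a + 𝟙 b ≟ 2 ⌋ + 𝟙 ⌊ 1 + 𝟙 a + 𝟙 b ≟ 1 ⌋
      T V e : ℕ
      T = edgeSum B (λ j k → q (lookup S j) (lookup S k))
      V = vol₃ (cone B) (true ∷ S)
      e = edgeSum B (λ j k → 1)
      t≡ = t₂+t₁-cone free true S
      vol≡ : V ≡ e + ∣ S ∣ * d
      vol≡ = trans (vol₃-cone free true S)
        (trans (edgeSum-+ B (λ j k → 1) (λ j k → χ S j + χ S k)) (cong (e +_) (handshake-subset S)))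
      2e≡nd : e + e ≡ n * d
      2e≡nd = trans (sym (edgeSum-+ B (λ j k → 1) (λ j k → 1))) handshake-all
      -- If the triangle is inside S, both ends of the edge are in S.
      pointwise : ∀ a b → 2 ≤ q a b + q a b + (𝟙 a + 𝟙 b)
      pointwise false false = s≤s (s≤s z≤n)
      pointwise false true  = s≤s (s≤s z≤n)
      pointwise true  false = s≤s (s≤s z≤n)
      pointwise true  true  = s≤s (s≤s z≤n)
      open ≤-Reasoning
      1+2∣S∣≤n : 1 + (∣ S ∣ + ∣ S ∣) ≤ n
      1+2∣S∣≤n = s≤s⁻¹ (subst (_≤ suc n) (shift ∣ S ∣) 2∣S∣≤n)
        where
        shift : ∀ x → 2 * suc x ≡ suc (1 + (x + x))
        shift = solve-∀
      2∣S∣d≤nd : ∣ S ∣ * d + ∣ S ∣ * d ≤ n * d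
      2∣S∣d≤nd = subst (_≤ n * d) (*-distribʳ-+ d ∣ S ∣ ∣ S ∣)
        (*-monoˡ-≤ d (≤-trans (n≤1+n _) 1+2∣S∣≤n))
      nd≤2T+∣S∣d : n * d ≤ T + T + ∣ S ∣ * d
      nd≤2T+∣S∣d = begin
        n * d                ≡⟨ handshake-all ⟨
        edgeSum B (λ j k → 2) ≤⟨ edgeSum-mono B (λ j k → pointwise (lookup S j) (lookup S k)) ⟩
        _                    ≡⟨ edgeSum-+ B _ (λ j k → χ S j + χ S k) ⟩
        _                    ≡⟨ cong₂ _+_ (edgeSum-+ B _ _) (handshake-subset S) ⟩
        T + T + ∣ S ∣ * d    ∎
      nd≤4T : n * d ≤ 4 * T
      nd≤4T = +-cancelʳ-≤ (n * d) (n * d) (4 * T) (begin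
        n * d + n * d                               ≤⟨ +-mono-≤ nd≤2T+∣S∣d nd≤2T+∣S∣d ⟩
        T + T + ∣ S ∣ * d + (T + T + ∣ S ∣ * d)     ≡⟨ regroup T (∣ S ∣ * d) ⟩
        4 * T + (∣ S ∣ * d + ∣ S ∣ * d)             ≤⟨ +-monoʳ-≤ (4 * T) 2∣S∣d≤nd ⟩
        4 * T + n * d                               ∎)
        where
        regroup : ∀ x y → x + x + y + (x + x + y) ≡ 4 * x + (y + y)
        regroup = solve-∀
      2V≡ : V + V ≡ n * d + (∣ S ∣ * d + ∣ S ∣ * d)
      2V≡ = trans (cong₂ _+_ vol≡ vol≡)
        (trans (regroup e (∣ S ∣ * d)) (cong (_+ (∣ S ∣ * d + ∣ S ∣ * d)) 2e≡nd))
        where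
        regroup : ∀ x y → x + y + (x + y) ≡ x + x + (y + y)
        regroup = solve-∀
      vol≤4T : V ≤ 4 * T
      vol≤4T = ≤-trans (*-cancelˡ-≤ 2 (begin
        2 * V                                   ≡⟨ cong (V +_) (+-identityʳ V) ⟩
        V + V                                   ≡⟨ 2V≡ ⟩
        n * d + (∣ S ∣ * d + ∣ S ∣ * d)         ≤⟨ +-monoʳ-≤ (n * d) 2∣S∣d≤nd ⟩
        n * d + n * d                           ≡⟨ cong (n * d +_) (+-identityʳ (n * d)) ⟨
        2 * (n * d)                             ∎)) nd≤4T
      0<vol : 0 < V
      0<vol = *-cancelˡ-< 2 0 V (begin-strict
        0                                ≤⟨ z≤n ⟩
        0 * d                            <⟨ *-monoˡ-< d {{>-nonZero 0<d}} (≤-trans (s≤s z≤n) 1+2∣S∣≤n) ⟩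
        n * d                            ≤⟨ m≤m+n (n * d) _ ⟩
        n * d + (∣ S ∣ * d + ∣ S ∣ * d)  ≡⟨ 2V≡ ⟨
        V + V                            ≡⟨ cong (V +_) (+-identityʳ V) ⟨
        2 * V                            ∎)

-- Edge expansion of cones

-- No edge of G joins S to T.
Separated : Graph n → Subset n → Subset n → Set
Separated G S T = ∀ i j → lookup S i ∧ lookup T j ∧ adj G i j ≡ false

module _ (B : Graph n) where

  -- Only the edges to the apex cross between S and T.
  cut-cone-base : ∀ S T → Separated B S T → cut (cone B) (false ∷ S) (true ∷ T) ≡ ∣ S ∣
  cut-cone-base S T sep = begin
    sum {n} (λ _ → 0)
      + ∑[ i < n ] (𝟙 (lookup S i ∧ true) + ∑[ j < n ] 𝟙 (lookup S i ∧ lookup T j ∧ adj B i j))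
      ≡⟨ cong₂ _+_ (sum-zero {n} (λ _ → refl)) (sum-cong-≗ λ i → cong₂ _+_
           (cong 𝟙 (∧-identityʳ (lookup S i))) (sum-zero λ j → cong 𝟙 (sep i j))) ⟩
    ∑[ i < n ] (χ S i + 0)
      ≡⟨ sum-cong-≗ (λ i → +-identityʳ (χ S i)) ⟩
    sum (χ S)
      ≡⟨ ∣∣≡sum S ⟨
    ∣ S ∣ ∎
    where open ≡-Reasoning

  cut-cone-apex : ∀ S T → Separated B S T → cut (cone B) (true ∷ S) (false ∷ T) ≡ ∣ T ∣
  cut-cone-apex S T sep = begin
    ∑[ j < n ] 𝟙 (lookup T j ∧ true)
      + ∑[ i < n ] (𝟙 (lookup S i ∧ false) + ∑[ j < n ] 𝟙 (lookup S i ∧ lookup T j ∧ adj B i j))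
      ≡⟨ cong₂ _+_ (sum-cong-≗ λ j → cong 𝟙 (∧-identityʳ (lookup T j)))
           (sum-zero λ i → cong₂ _+_ (cong 𝟙 (∧-zeroʳ (lookup S i))) (sum-zero λ j → cong 𝟙 (sep i j))) ⟩
    sum (χ T) + 0
      ≡⟨ +-identityʳ (sum (χ T)) ⟩
    sum (χ T)
      ≡⟨ ∣∣≡sum T ⟨
    ∣ T ∣ ∎
    where open ≡-Reasoning

  deg-apex : deg (cone B) zero ≡ n
  deg-apex = trans (sum-const n 1) (*-identityʳ n)

  n≤vol-apex : ∀ S → n ≤ vol (cone B) (true ∷ S)
  n≤vol-apex S = ≤-trans
    (≤-reflexive (sym (trans (*-identityˡ (deg (cone B) zero)) deg-apex)))
    (m≤m+n (1 * deg (cone B) zero) _)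

  module _ {d : ℕ} (regular : Regular d B) where

    vol-base : ∀ S → vol (cone B) (false ∷ S) ≡ ∣ S ∣ * suc d
    vol-base S = begin
      ∑[ v < n ] (χ S v * suc (deg B v))
        ≡⟨ sum-cong-≗ (λ v → trans (cong (λ x → χ S v * suc x) (regular v)) (*-comm (χ S v) (suc d))) ⟩
      ∑[ v < n ] (suc d * χ S v)
        ≡⟨ *-distribˡ-sum (suc d) (χ S) ⟨
      suc d * sum (χ S)
        ≡⟨ *-comm (suc d) (sum (χ S)) ⟩
      sum (χ S) * suc d
        ≡⟨ cong (_* suc d) (∣∣≡sum S) ⟨
      ∣ S ∣ * suc d ∎
      where open ≡-Reasoning

    vol-apex-lower : ∀ S → ∣ S ∣ * suc d ≤ vol (cone B) (true ∷ S)
    vol-apex-lower S = ≤-trans (≤-reflexive (sym (vol-base S)))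
      (m≤n+m (vol (cone B) (false ∷ S)) (1 * deg (cone B) zero))

    φ-cone-upper : ∀ S → Separated B S (∁ S) → 2 * ∣ S ∣ ≤ n →
      φ (cone B) (false ∷ S) ℚ.≤ 1/[1+ d ]
    φ-cone-upper S sep 2∣S∣≤n = ratio-upper d (begin
      cut (cone B) (false ∷ S) (true ∷ ∁ S) * suc d
        ≡⟨ cong (_* suc d) (cut-cone-base S (∁ S) sep) ⟩
      ∣ S ∣ * suc d
        ≤⟨ ⊓-glb (≤-reflexive (sym (vol-base S)))
             (≤-trans (*-monoˡ-≤ (suc d) ∣S∣≤∣∁S∣) (vol-apex-lower (∁ S))) ⟩
      vol (cone B) (false ∷ S) ⊓ vol (cone B) (true ∷ ∁ S) ∎)
      where
      open ≤-Reasoning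
      ∣S∣≤∣∁S∣ : ∣ S ∣ ≤ ∣ ∁ S ∣
      ∣S∣≤∣∁S∣ = subst (∣ S ∣ ≤_) (sym (∣∁p∣≡n∸∣p∣ S))
        (m+n≤o⇒m≤o∸n ∣ S ∣ (subst (_≤ n) (cong (∣ S ∣ +_) (+-identityʳ ∣ S ∣)) 2∣S∣≤n))

-- Stars

-- The graph on n vertices without edges; the cone over it is the star with n leaves.
edgeless : ∀ n → Graph n
edgeless n = record
  { adj = λ _ _ → false ; adj-sym = λ _ _ → refl ; adj-irrefl = λ _ → refl }

edgeless-separated : (S T : Subset n) → Separated (edgeless n) S T
edgeless-separated S T i j = trans (cong (lookup S i ∧_) (∧-zeroʳ (lookup T j))) (∧-zeroʳ (lookup S i))

edgeless-regular : Regular 0 (edgeless n)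
edgeless-regular {n} v = sum-zero {n} (λ _ → refl)

edgeSum-edgeless : (w : Fin n → Fin n → ℕ) → edgeSum (edgeless n) w ≡ 0
edgeSum-edgeless {n} w = sum-zero λ j → sum-zero λ k →
  cong (λ b → 𝟙 b * w j k) (∧-zeroʳ ⌊ j Fin.<? k ⌋)

vol-star : (S : Subset n) → vol (cone (edgeless n)) (false ∷ S) ≡ ∣ S ∣
vol-star {n} S = trans (vol-base (edgeless n) edgeless-regular S) (*-identityʳ ∣ S ∣)

-- In each of the two cases the minimum of the volumes is at most the volume of the
-- set of leaves on the side without the centre, and that volume is the cut.
star-hasEdgeExpansion : HasEdgeExpansion (cone (edgeless n)) 1ℚ
star-hasEdgeExpansion {n} (false ∷ S) (suc v , there v∈S) _ =
  ratio-lower 0 (⊓-glb 0<vol (<-≤-trans 0<n (n≤vol-apex (edgeless n) (∁ S)))) (begin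
    vol★ (false ∷ S) ⊓ vol★ (true ∷ ∁ S)   ≤⟨ m⊓n≤m _ (vol★ (true ∷ ∁ S)) ⟩
    vol★ (false ∷ S)                       ≡⟨ vol-star S ⟩
    ∣ S ∣                                  ≡⟨ cut-cone-base (edgeless n) S (∁ S) (edgeless-separated S (∁ S)) ⟨
    cut★ (false ∷ S) (true ∷ ∁ S)          ≡⟨ *-identityˡ _ ⟨
    1 * cut★ (false ∷ S) (true ∷ ∁ S)      ∎)
  where
  open ≤-Reasoning
  vol★ = vol (cone (edgeless n))
  cut★ = cut (cone (edgeless n))
  0<vol : 0 < vol★ (false ∷ S)
  0<vol = subst (0 <_) (sym (vol-star S)) (∈⇒0<∣∣ v∈S)
  0<n : 0 < n
  0<n = <-≤-trans (∈⇒0<∣∣ v∈S) (∣p∣≤n S)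
star-hasEdgeExpansion {n} (true ∷ S) _ 2∣S∣≤n =
  ratio-lower 0 (⊓-glb (<-≤-trans 0<n (n≤vol-apex (edgeless n) S)) 0<vol) (begin
    vol★ (true ∷ S) ⊓ vol★ (false ∷ ∁ S)   ≤⟨ m⊓n≤n (vol★ (true ∷ S)) _ ⟩
    vol★ (false ∷ ∁ S)                     ≡⟨ vol-star (∁ S) ⟩
    ∣ ∁ S ∣                                ≡⟨ cut-cone-apex (edgeless n) S (∁ S) (edgeless-separated S (∁ S)) ⟨
    cut★ (true ∷ S) (false ∷ ∁ S)          ≡⟨ *-identityˡ _ ⟨
    1 * cut★ (true ∷ S) (false ∷ ∁ S)      ∎)
  where
  open ≤-Reasoning
  vol★ = vol (cone (edgeless n))
  cut★ = cut (cone (edgeless n))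
  ∣S∣<n : ∣ S ∣ < n
  ∣S∣<n = s≤s⁻¹ (≤-trans (s≤s (s≤s (m≤m+n ∣ S ∣ ∣ S ∣)))
    (subst (_≤ suc n) (shift ∣ S ∣) 2∣S∣≤n))
    where
    shift : ∀ x → 2 * suc x ≡ suc (suc (x + x))
    shift = solve-∀
  0<n : 0 < n
  0<n = ≤-<-trans z≤n ∣S∣<n
  0<vol : 0 < vol★ (false ∷ ∁ S)
  0<vol = subst (0 <_) (sym (trans (vol-star (∁ S)) (∣∁p∣≡n∸∣p∣ S))) (m<n⇒0<n∸m ∣S∣<n)

φ₃-star : (S : Subset (suc n)) → φ₃ (cone (edgeless n)) S ≡ 0ℚ
φ₃-star {n} (h ∷ S) = trans
  (cong (λ a → ratio a (vol₃ (cone (edgeless n)) (h ∷ S))) no-triangles)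
  (ratio-zero (vol₃ (cone (edgeless n)) (h ∷ S)))
  where
  no-triangles : t⟨ cone (edgeless n) ⟩ 2 (h ∷ S) + t⟨ cone (edgeless n) ⟩ 1 (h ∷ S) ≡ 0
  no-triangles = trans (t₂+t₁-cone (edgeless n) (λ _ _ _ → refl) h S)
    (edgeSum-edgeless {n} _)
  ratio-zero : ∀ b → ratio 0 b ≡ 0ℚ
  ratio-zero zero    = refl
  ratio-zero (suc b) = ℚ.0/n≡0 (suc b)

-- Stars with k + 1 leaves.
stars : GraphFamily
stars = record
  { size   = λ k → 2 + k
  ; graph  = λ k → cone (edgeless (suc k))
  ; size→∞ = λ N → N , λ k N≤k → ≤-trans N≤k (m≤n+m k 2)
  }

stars-isEdgeExpander : IsEdgeExpander stars
stars-isEdgeExpander = 1ℚ , ℚ.positive⁻¹ 1ℚ , 0 , λ _ _ → star-hasEdgeExpansion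

stars-¬isTriangleExpander : ¬ IsTriangleExpander stars
stars-¬isTriangleExpander (c , 0<c , K , expanding) = ℚ.<-irrefl refl (ℚ.<-≤-trans 0<c
  (subst (c ℚ.≤_) (φ₃-star S)
    (expanding K ≤-refl S (zero , x∈⁅x⁆ zero)
      (subst (λ s → 2 * s ≤ 2 + K) (sym (∣⁅x⁆∣≡1 {2 + K} zero)) (s≤s (s≤s z≤n))))))
  where
  S : Subset (2 + K)
  S = ⁅ zero ⁆

-- Two disjoint complete bipartite graphs

-- The vertices fall into four classes of m vertices: the first coordinate is the
-- copy of K(m,m), the second the side within that copy. The classes repeat with
-- period 4 along the vertices.
class : ∀ m → Fin (m * 4) → Bool × Bool
class (suc m) zero                          = false , false
class (suc m) (suc zero)                    = false , true
class (suc m) (suc (suc zero))              = true  , false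
class (suc m) (suc (suc (suc zero)))        = true  , true
class (suc m) (suc (suc (suc (suc v))))     = class m v

sum-class : ∀ m (f : Bool × Bool → ℕ) → ∑[ v < m * 4 ] f (class m v) ≡
  m * (f (false , false) + f (false , true) + f (true , false) + f (true , true))
sum-class zero    f = refl
sum-class (suc m) f = trans
  (cong (λ x → f (false , false) + (f (false , true) + (f (true , false) + (f (true , true) + x))))
    (sum-class m f))
  (regroup (f (false , false)) (f (false , true)) (f (true , false)) (f (true , true)) _)
  where
  regroup : ∀ a b c d x → a + (b + (c + (d + x))) ≡ a + b + c + d + x
  regroup = solve-∀

-- Adjacency of classes: same copy, opposite sides.
joined : Bool × Bool → Bool × Bool → Bool
joined (c , s) (c′ , s′) = not (c xor c′) ∧ (s xor s′)

joined-sym : ∀ x y → joined x y ≡ joined y x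
joined-sym (c , s) (c′ , s′) = cong₂ (λ a b → not a ∧ b) (xor-comm c c′) (xor-comm s s′)

joined-irrefl : ∀ x → joined x x ≡ false
joined-irrefl (c , s) = trans (cong (not (c xor c) ∧_) (xor-same s)) (∧-zeroʳ _)

-- Two of any three vertices of a copy are on the same side.
joined-triangleFree : ∀ x y z → joined x y ∧ joined y z ∧ joined x z ≡ false
joined-triangleFree (c , s) (c′ , s′) (c″ , s″) =
  cases (not (c xor c′)) (not (c′ xor c″)) (not (c xor c″)) s s′ s″
  where
  cases : ∀ a b e s s′ s″ → (a ∧ (s xor s′)) ∧ (b ∧ (s′ xor s″)) ∧ (e ∧ (s xor s″)) ≡ false
  cases false b     e     s     s′    s″    = refl
  cases true  false e     s     s′    s″    = ∧-zeroʳ (s xor s′)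
  cases true  true  false s     s′    s″    =
    trans (cong ((s xor s′) ∧_) (∧-zeroʳ (s′ xor s″))) (∧-zeroʳ (s xor s′))
  cases true  true  true  false false s″    = refl
  cases true  true  true  false true  false = refl
  cases true  true  true  false true  true  = refl
  cases true  true  true  true  true  s″    = refl
  cases true  true  true  true  false false = refl
  cases true  true  true  true  false true  = refl

-- The disjoint union of two copies of K(m,m).
twoBicliques : ∀ m → Graph (m * 4)
twoBicliques m = record
  { adj        = λ u v → joined (class m u) (class m v)
  ; adj-sym    = λ u v → joined-sym (class m u) (class m v)
  ; adj-irrefl = λ u → joined-irrefl (class m u)
  }

twoBicliques-triangleFree : ∀ m → TriangleFree (twoBicliques m)
twoBicliques-triangleFree m i j k = joined-triangleFree (class m i) (class m j) (class m k)

twoBicliques-regular : ∀ m → Regular m (twoBicliques m)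
twoBicliques-regular m v = trans (sum-class m (λ y → 𝟙 (joined (class m v) y))) (one (class m v))
  where
  one : ∀ x → m * (𝟙 (joined x (false , false)) + 𝟙 (joined x (false , true))
    + 𝟙 (joined x (true , false)) + 𝟙 (joined x (true , true))) ≡ m
  one (false , false) = *-identityʳ m
  one (false , true)  = *-identityʳ m
  one (true  , false) = *-identityʳ m
  one (true  , true)  = *-identityʳ m

-- The vertices of one of the two copies.
copy : ∀ m → Subset (m * 4)
copy m = tabulate (proj₁ ∘ class m)

∣copy∣ : ∀ m → ∣ copy m ∣ ≡ m * 2
∣copy∣ m = trans (∣∣≡sum (copy m)) (trans
  (sum-cong-≗ λ v → cong 𝟙 (lookup∘tabulate (proj₁ ∘ class m) v))
  (sum-class m (𝟙 ∘ proj₁)))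

copy-separated : ∀ m → Separated (twoBicliques m) (copy m) (∁ (copy m))
copy-separated m i j = trans
  (cong₂ (λ a b → a ∧ b ∧ joined (class m i) (class m j))
    (lookup∘tabulate (proj₁ ∘ class m) i)
    (trans (lookup-map j not (copy m)) (cong not (lookup∘tabulate (proj₁ ∘ class m) j))))
  (cases (class m i) (class m j))
  where
  cases : ∀ x y → proj₁ x ∧ not (proj₁ y) ∧ joined x y ≡ false
  cases (false , s) y            = refl
  cases (true  , s) (false , s′) = refl
  cases (true  , s) (true  , s′) = refl

-- The cone over two copies of K(k+1,k+1).
bicliqueCones : GraphFamily
bicliqueCones = record
  { size   = λ k → suc (suc k * 4)
  ; graph  = λ k → cone (twoBicliques (suc k))
  ; size→∞ = λ N → N , λ k N≤k →
      ≤-trans N≤k (≤-trans (m≤m*n k 4) (≤-trans (m≤n+m (k * 4) 4) (n≤1+n _)))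
  }

bicliqueCones-isTriangleExpander : IsTriangleExpander bicliqueCones
bicliqueCones-isTriangleExpander = 1/[1+ 3 ] , ℚ.positive⁻¹ 1/[1+ 3 ] , 0 , λ k _ →
  cone-hasTriangleExpansion (twoBicliques (suc k)) (twoBicliques-regular (suc k))
    (twoBicliques-triangleFree (suc k)) z<s

bicliqueCones-¬isEdgeExpander : ¬ IsEdgeExpander bicliqueCones
bicliqueCones-¬isEdgeExpander (c , 0<c , K , expanding) = ℚ.<-irrefl refl (begin-strict
  c
    ≤⟨ expanding k (m≤m⊔n K N) (false ∷ S) nonempty (≤-trans 2∣S∣≤4m (n≤1+n _)) ⟩
  φ (cone (twoBicliques m)) (false ∷ S)
    ≤⟨ φ-cone-upper (twoBicliques m) (twoBicliques-regular m) S (copy-separated m) 2∣S∣≤4m ⟩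
  1/[1+ m ]
    <⟨ small m (≤-trans (m≤n⊔m K N) (n≤1+n k)) ⟩
  c ∎)
  where
  open ℚ.≤-Reasoning
  N = proj₁ (archimedean 0<c)
  small = proj₂ (archimedean 0<c)
  k = K ⊔ N
  m = suc k
  S = copy m
  -- The apex is vertex 0, and vertices 1 and 2 are in the other copy.
  nonempty : Nonempty (false ∷ S)
  nonempty = suc (suc (suc zero)) , there (there (there here))
  2∣S∣≤4m : 2 * ∣ S ∣ ≤ m * 4
  2∣S∣≤4m = ≤-reflexive (trans (cong (2 *_) (∣copy∣ m)) (regroup m))
    where
    regroup : ∀ x → 2 * (x * 2) ≡ x * 4
    regroup = solve-∀

theorem5 : (Σ[ 𝒢 ∈ GraphFamily ] (IsEdgeExpander 𝒢 × ¬ IsTriangleExpander 𝒢))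
    × (RandomTriangleExpanderConjecture →
    Σ[ 𝒢 ∈ GraphFamily ] (IsTriangleExpander 𝒢 × ¬ IsEdgeExpander 𝒢))
theorem5 =
  (stars , stars-isEdgeExpander , stars-¬isTriangleExpander) ,
  λ _ → bicliqueCones , bicliqueCones-isTriangleExpander , bicliqueCones-¬isEdgeExpander
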